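{- Let $\mathcal{S}\subseteq\mathcal{V}$ and $\mathcal{F}\subseteq\mathcal{V}^*$, with $\mathbf{D}=\mathbf{D}_{\mathcal{S}}$, $\overline{\mathbf{D}}=\mathbf{I}-\mathbf{D}$, $\mathbf{B}=\mathbf{B}_{\mathcal{F}}$, and let $\mathcal{B}=\{x\in\mathbb{C}^N:\mathbf{B}x=x\}$. It is possible to recover every $x\in\mathcal{B}$ from its samples $x_{\mathcal{S}}:=\mathbf{D}x$ (i.e. there exists a matrix $\mathbf{Q}\in\mathbb{C}^{N\times N}$ such that $\mathbf{Q}\mathbf{D}x=x$ for all $x\in\mathcal{B}$) if and only if $$\|\mathbf{B}\overline{\mathbf{D}}\|_2<1,$$ i.e. if the matrix $\mathbf{B}\overline{\mathbf{D}}\mathbf{B}$ does not have any eigenvector that is perfectly localized on $\overline{\mathcal{S}}$ and band-limited on $\mathcal{F}$ (an eigenvector $y$ with $\overline{\mathbf{D}}y=y$ and $\mathbf{B}y=y$).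
   Context: $\mathcal{V}=\{1,\dots,N\}$ is the vertex set of a graph and $\mathcal{V}^*=\{1,\dots,N\}$ is the set of frequency indices. $\mathbf{U}\in\mathbb{C}^{N\times N}$ is a fixed arbitrary unitary matrix. For $\mathcal{S}\subseteq\mathcal{V}$, $\mathbf{D}_{\mathcal{S}}$ is the diagonal matrix whose $i$-th diagonal entry is $1$ if $i\in\mathcal{S}$ and $0$ otherwise; $\overline{\mathcal{S}}=\mathcal{V}\setminus\mathcal{S}$. For $\mathcal{F}\subseteq\mathcal{V}^*$, $\mathbf{B}_{\mathcal{F}}=\mathbf{U}\mathbf{\Sigma}_{\mathcal{F}}\mathbf{U}^*$, where $\mathbf{\Sigma}_{\mathcal{F}}$ is the diagonal $0/1$ matrix with $i$-th diagonal entry $1$ if and only if $i\in\mathcal{F}$. $\|\cdot\|_2$ of a matrix is the spectral norm (largest singular value). Recovery for all $x\in\mathcal{B}$ is equivalently the statement that $x\mapsto\mathbf{D}x$ is injective on $\mathcal{B}$. -}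

module Defs where

open import Level using (Level; _⊔_; suc)
open import Algebra.Bundles using (CommutativeRing; RawRing)
open import Algebra.Structures using (IsCommutativeRing)
import Algebra.Definitions.RawMonoid as RawMonoidDefinitions
open import Data.Bool.Base using (if_then_else_)
open import Data.Fin.Base using (Fin)
open import Data.Fin.Properties using (_≟_)
open import Data.Fin.Subset using (Subset)
open import Data.Fin.Subset.Properties using (_∈?_)
open import Data.Nat.Base using (ℕ)
open import Data.Product using (∃; _×_)
open import Data.Vec.Functional using (Vector)
open import Relation.Binary.Core using (Rel)
open import Relation.Binary.Structures using (IsDecTotalOrder)
import Relation.Binary.Construct.NonStrictToStrict as ToStrict
open import Relation.Nullary using (¬_; does)
open import Relation.Unary using (Pred; Satisfiable)

private
  variable
    n : ℕ

-- The classical real numbers, axiomatised as a Dedekind-complete ordered field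
-- (unique up to isomorphism).  Decidability of the order is the classical
-- trichotomy law.  Equality is a setoid equality, so that quotient-free
-- representations such as Cauchy sequences are covered.

record RealNumbers (c ℓ₁ ℓ₂ : Level) : Set (suc (c ⊔ ℓ₁ ⊔ ℓ₂)) where
  infix  8 -_
  infixl 7 _*_
  infixl 6 _+_
  infix  4 _≈_ _≤_
  field
    Carrier           : Set c
    _≈_               : Rel Carrier ℓ₁
    _≤_               : Rel Carrier ℓ₂
    _+_ _*_           : Carrier → Carrier → Carrier
    -_                : Carrier → Carrier
    0# 1#             : Carrier
    isCommutativeRing : IsCommutativeRing _≈_ _+_ _*_ -_ 0# 1#
    0≉1               : ¬ (0# ≈ 1#)
    inverse           : ∀ x → ¬ (x ≈ 0#) → ∃ λ y → x * y ≈ 1#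
    isDecTotalOrder   : IsDecTotalOrder _≈_ _≤_
    +-monoʳ-≤         : ∀ x {y z} → y ≤ z → x + y ≤ x + z
    *-nonNegative     : ∀ {x y} → 0# ≤ x → 0# ≤ y → 0# ≤ x * y

  IsUpperBound : ∀ {ℓ} → Pred Carrier ℓ → Carrier → Set (c ⊔ ℓ₂ ⊔ ℓ)
  IsUpperBound P b = ∀ x → P x → x ≤ b

  IsSupremum : ∀ {ℓ} → Pred Carrier ℓ → Carrier → Set (c ⊔ ℓ₂ ⊔ ℓ)
  IsSupremum P s = IsUpperBound P s × (∀ b → IsUpperBound P b → s ≤ b)

  field
    supremum : (P : Pred Carrier (c ⊔ ℓ₁ ⊔ ℓ₂)) →
               Satisfiable P → ∃ (IsUpperBound P) → ∃ (IsSupremum P)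

  open ToStrict _≈_ _≤_ public using (_<_)

  commutativeRing : CommutativeRing c ℓ₁
  commutativeRing = record { isCommutativeRing = isCommutativeRing }

module ComplexMatrices {c ℓ₁ ℓ₂} (R : RealNumbers c ℓ₁ ℓ₂) where

  private
    module ℝ = RealNumbers R

  ℝ : Set c
  ℝ = ℝ.Carrier

  1ℝ : ℝ
  1ℝ = ℝ.1#

  record ℂ : Set c where
    constructor _+i_
    field
      re im : ℝ

  open ℂ public

  ℂ-rawRing : RawRing c ℓ₁
  ℂ-rawRing = record
    { Carrier = ℂ
    ; _≈_     = λ z w → (re z ℝ.≈ re w) × (im z ℝ.≈ im w)
    ; _+_     = λ z w → (re z ℝ.+ re w) +i (im z ℝ.+ im w)
    ; _*_     = λ z w → (re z ℝ.* re w ℝ.+ ℝ.- (im z ℝ.* im w))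
                     +i (re z ℝ.* im w ℝ.+ im z ℝ.* re w)
    ; -_      = λ z → (ℝ.- re z) +i (ℝ.- im z)
    ; 0#      = ℝ.0# +i ℝ.0#
    ; 1#      = ℝ.1# +i ℝ.0#
    }

  open RawRing ℂ-rawRing public
    using (_≈_; _+_; _*_; -_; 0#; 1#; +-rawMonoid)
  open RawMonoidDefinitions +-rawMonoid public using (sum)

  conj : ℂ → ℂ
  conj z = re z +i (ℝ.- im z)

  fromℝ : ℝ → ℂ
  fromℝ x = x +i ℝ.0#

  Matrix : ℕ → Set c
  Matrix n = Fin n → Fin n → ℂ

  infix  4 _≈ᵛ_ _≈ᵐ_
  infixl 6 _-ᵐ_
  infixl 7 _*ᵐ_
  infixr 7 _*ᵥ_ _·ᵥ_
  infix  8 _ᴴ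
  infix  4 ∥_∥₂<_

  _≈ᵛ_ : Rel (Vector ℂ n) ℓ₁
  x ≈ᵛ y = ∀ i → x i ≈ y i

  _≈ᵐ_ : Rel (Matrix n) ℓ₁
  A ≈ᵐ B = ∀ i j → A i j ≈ B i j

  0ᵛ : Vector ℂ n
  0ᵛ _ = 0#

  _·ᵥ_ : ℂ → Vector ℂ n → Vector ℂ n
  (μ ·ᵥ x) i = μ * x i

  _*ᵥ_ : Matrix n → Vector ℂ n → Vector ℂ n
  (A *ᵥ x) i = sum λ j → A i j * x j

  _*ᵐ_ : Matrix n → Matrix n → Matrix n
  (A *ᵐ B) i k = sum λ j → A i j * B j k

  _-ᵐ_ : Matrix n → Matrix n → Matrix n
  (A -ᵐ B) i j = A i j + - B i j

  _ᴴ : Matrix n → Matrix n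
  (A ᴴ) i j = conj (A j i)

  diagonal : Vector ℂ n → Matrix n
  diagonal d i j = if does (i ≟ j) then d i else 0#

  I : Matrix n
  I = diagonal λ _ → 1#

  IsUnitary : Matrix n → Set ℓ₁
  IsUnitary U = ((U ᴴ *ᵐ U) ≈ᵐ I) × ((U *ᵐ U ᴴ) ≈ᵐ I)

  IsEigenpair : Matrix n → ℂ → Vector ℂ n → Set ℓ₁
  IsEigenpair A μ v = ¬ (v ≈ᵛ 0ᵛ) × (A *ᵥ v ≈ᵛ μ ·ᵥ v)

  IsEigenvector : Matrix n → Vector ℂ n → Set (c ⊔ ℓ₁)
  IsEigenvector A v = ∃ λ μ → IsEigenpair A μ v

  IsEigenvalue : Matrix n → ℂ → Set (c ⊔ ℓ₁)
  IsEigenvalue A μ = ∃ λ v → IsEigenpair A μ v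

  -- Singular values are the nonnegative square roots of the eigenvalues of Aᴴ A.

  IsSingularValue : Matrix n → ℝ → Set (c ⊔ ℓ₁ ⊔ ℓ₂)
  IsSingularValue A σ = (ℝ.0# ℝ.≤ σ) × IsEigenvalue (A ᴴ *ᵐ A) (fromℝ (σ ℝ.* σ))

  IsSpectralNorm : Matrix n → ℝ → Set (c ⊔ ℓ₁ ⊔ ℓ₂)
  IsSpectralNorm A σ = IsSingularValue A σ × (∀ τ → IsSingularValue A τ → τ ℝ.≤ σ)

  -- The spectral norm is given as a relation rather than a function; its value
  -- is unique (by maximality), and ∥ A ∥₂< r says that it exists and is
  -- smaller than r.

  ∥_∥₂<_ : Matrix n → ℝ → Set (c ⊔ ℓ₁ ⊔ ℓ₂)
  ∥ A ∥₂< r = ∃ λ σ → IsSpectralNorm A σ × (σ ℝ.< r)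

  indicator : Subset n → Vector ℂ n
  indicator S i = if does (i ∈? S) then 1# else 0#

  𝐃 : Subset n → Matrix n
  𝐃 S = diagonal (indicator S)

  𝐃̄ : Subset n → Matrix n
  𝐃̄ S = I -ᵐ 𝐃 S

  𝐁 : Matrix n → Subset n → Matrix n
  𝐁 U F = U *ᵐ diagonal (indicator F) *ᵐ U ᴴ

  Fixes : Matrix n → Vector ℂ n → Set ℓ₁
  Fixes P x = P *ᵥ x ≈ᵛ x

  Recoverable : (D P : Matrix n) → Set (c ⊔ ℓ₁)
  Recoverable D P = ∃ λ Q → ∀ x → Fixes P x → Q *ᵥ D *ᵥ x ≈ᵛ x

-- Write A = B D̄.  For x ∈ ℂᴺ, Pythagoras applied twice gives
-- ∥x∥² - ∥A x∥² = ∥D x∥² + ∥D̄ x - A x∥², so a vector that A does not shrink is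
-- localized: D x = 0 and B x = x.  Hence the singular values of A are below 1
-- unless a localized vector exists, which is then a singular vector for 1.  The
-- matrix I - A either has a kernel vector, which is localized, or a left
-- inverse L, and then L B recovers x from D x because I - A and B D agree on
-- band-limited vectors.
--
-- The largest singular value is found as the supremum s of ∥A x∥² / ∥x∥²: if
-- s - Aᴴ A were invertible it would be bounded below by some t > 0, making s - t
-- a smaller upper bound.  As the order is decidable, elimination decides
-- singularity and produces the eigenvector; no compactness is needed.

module Submission where

open import Defs
open import Algebra.Bundles using (CommutativeRing)
import Algebra.Properties.Semiring.Sum as SemiringSum
open import Algebra.Solver.Ring.AlmostCommutativeRing
  using (fromCommutativeRing; _-Raw-AlmostCommutative⟶_)
open import Data.Bool.Base using (Bool; true; false; if_then_else_)
open import Data.Fin.Base using (Fin; zero; suc)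
import Data.Fin.Properties as Fin
open import Data.Fin.Subset using (Subset)
open import Data.Fin.Subset.Properties using (_∈?_)
open import Data.Integer.Base as ℤ using (ℤ; +_; -[1+_])
import Data.Integer.Properties as ℤ
open import Data.Maybe.Base as Maybe using (Maybe)
open import Data.Nat.Base as ℕ using (ℕ; zero; suc; NonZero)
import Data.Nat.Properties as ℕ
open import Data.Product using (∃; _×_; _,_; proj₁; proj₂)
open import Data.Sum.Base using (_⊎_; inj₁; inj₂; fromInj₁; fromInj₂)
open import Data.Vec.Functional using (Vector; _∷_; head; tail)
open import Function.Base using (_∘_)
open import Function.Bundles using (_⇔_; mk⇔)
open import Level using (Lift; lift; lower; _⊔_)
open import Relation.Binary.Definitions using (Decidable)
import Relation.Binary.PropositionalEquality as ≡
open import Relation.Binary.Structures using (IsDecTotalOrder)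
open import Relation.Nullary using (¬_; Dec; yes; no; does; contradiction)
open import Relation.Nullary.Decidable using (dec⇒maybe; _×-dec_)

-- Two obstacles shape the argument. First, `B D` itself cannot be inverted to recover `x`: as a
-- matrix on the whole space it is singular as soon as `D` or `B` is a proper projection. `I - B D̄`
-- agrees with it where it matters, and is injective on the whole space exactly when no localized
-- vector exists. Second, the logic is constructive while the conclusions carry data: `Recoverable`
-- asserts a matrix, and `∥ A ∥₂< 1ℝ` asserts a maximal singular value together with its singular
-- vector. The mere absence of a localized vector has to be turned into such data, and the dichotomy
-- between a kernel vector and a left inverse does this in both cases. The geometry uses only the
-- real part of the Hermitian product. It yields the same norms, keeps `A ᴴ` as the adjoint, and
-- still separates vectors, so every estimate stays in the ordered field.

-- Integer polynomial identities in a commutative ring.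

-- Coefficients are integers because the carrier itself has no equality test
-- that computes, and the solver needs one to cancel x - x.

module IntegerRingSolver {c ℓ} (K : CommutativeRing c ℓ) where
  open CommutativeRing K
  open import Algebra.Properties.Ring ring
    using (-‿distribˡ-*; -‿distribʳ-*; -0#≈0#; -‿involutive; -‿+-comm)
  open import Algebra.Properties.Semiring.Mult.TCOptimised semiring
    using (1+×; ×-homo-+; ×1-homo-*) renaming (_×_ to _×ℕ_)
  open import Relation.Binary.Reasoning.Setoid setoid

  private
    -- With the optimised multiple, `ι 1` reduces to `1#` instead of `1# + 0#`. Hence `1-homo` is
    -- `refl`, and `:1` in a solver goal denotes `1#` on the nose.
    ι : ℕ → Carrier
    ι n = n ×ℕ 1#

    fromℤ : ℤ → Carrier
    fromℤ (+ n)    = ι n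
    fromℤ -[1+ n ] = - ι (suc n)

    ⊖-homo : ∀ m n → fromℤ (m ℤ.⊖ n) ≈ ι m + - ι n
    ⊖-homo zero    zero    = sym (trans (+-congˡ -0#≈0#) (+-identityʳ 0#))
    ⊖-homo (suc m) zero    = sym (trans (+-congˡ -0#≈0#) (+-identityʳ _))
    ⊖-homo zero    (suc n) = sym (+-identityˡ _)
    ⊖-homo (suc m) (suc n) = begin
      fromℤ (suc m ℤ.⊖ suc n)            ≡⟨ ≡.cong fromℤ (ℤ.[1+m]⊖[1+n]≡m⊖n m n) ⟩
      fromℤ (m ℤ.⊖ n)                    ≈⟨ ⊖-homo m n ⟩
      ι m + - ι n                        ≈⟨ +-congʳ (+-identityʳ _) ⟨
      ι m + 0# + - ι n                   ≈⟨ +-congʳ (+-congˡ (-‿inverseʳ 1#)) ⟨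
      ι m + (1# + - 1#) + - ι n          ≈⟨ +-congʳ (+-assoc _ _ _) ⟨
      ι m + 1# + - 1# + - ι n            ≈⟨ +-assoc _ _ _ ⟩
      ι m + 1# + (- 1# + - ι n)          ≈⟨ +-cong (+-comm _ _) (-‿+-comm _ _) ⟩
      1# + ι m + - (1# + ι n)            ≈⟨ +-cong (1+× m 1#) (-‿cong (1+× n 1#)) ⟨
      ι (suc m) + - ι (suc n)            ∎

    -‿homo : ∀ i → fromℤ (ℤ.- i) ≈ - fromℤ i
    -‿homo (+ zero)  = sym -0#≈0#
    -‿homo (+ suc n) = refl
    -‿homo -[1+ n ]  = sym (-‿involutive _)

    +-homo : ∀ i j → fromℤ (i ℤ.+ j) ≈ fromℤ i + fromℤ j
    +-homo (+ m)    (+ n)    = ×-homo-+ 1# m n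
    +-homo (+ m)    -[1+ n ] = ⊖-homo m (suc n)
    +-homo -[1+ m ] (+ n)    = trans (⊖-homo n (suc m)) (+-comm _ _)
    +-homo -[1+ m ] -[1+ n ] = begin
      - ι (suc (suc (m ℕ.+ n)))      ≡⟨ ≡.cong (λ k → - ι k) (≡.sym (ℕ.+-suc (suc m) n)) ⟩
      - ι (suc m ℕ.+ suc n)          ≈⟨ -‿cong (×-homo-+ 1# (suc m) (suc n)) ⟩
      - (ι (suc m) + ι (suc n))      ≈⟨ -‿+-comm _ _ ⟨
      - ι (suc m) + - ι (suc n)      ∎

    *-homo : ∀ i j → fromℤ (i ℤ.* j) ≈ fromℤ i * fromℤ j
    *-homo (+ m)    (+ n)    = begin
      fromℤ (+ m ℤ.* + n)      ≡⟨ ≡.cong fromℤ (ℤ.pos-* m n) ⟨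
      ι (m ℕ.* n)              ≈⟨ ×1-homo-* m n ⟩
      ι m * ι n                ∎
    *-homo (+ m)    -[1+ n ] = begin
      fromℤ (+ m ℤ.* -[1+ n ])        ≡⟨ ≡.cong fromℤ (ℤ.-◃n≡-n (m ℕ.* suc n)) ⟩
      fromℤ (ℤ.- + (m ℕ.* suc n))     ≈⟨ -‿homo (+ (m ℕ.* suc n)) ⟩
      - ι (m ℕ.* suc n)               ≈⟨ -‿cong (×1-homo-* m (suc n)) ⟩
      - (ι m * ι (suc n))             ≈⟨ -‿distribʳ-* _ _ ⟩
      ι m * - ι (suc n)               ∎
    *-homo -[1+ m ] (+ n)    = begin
      fromℤ (-[1+ m ] ℤ.* + n)        ≡⟨ ≡.cong fromℤ (ℤ.-◃n≡-n (suc m ℕ.* n)) ⟩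
      fromℤ (ℤ.- + (suc m ℕ.* n))     ≈⟨ -‿homo (+ (suc m ℕ.* n)) ⟩
      - ι (suc m ℕ.* n)               ≈⟨ -‿cong (×1-homo-* (suc m) n) ⟩
      - (ι (suc m) * ι n)             ≈⟨ -‿distribˡ-* _ _ ⟩
      - ι (suc m) * ι n               ∎
    *-homo -[1+ m ] -[1+ n ] = begin
      ι (suc m ℕ.* suc n)             ≈⟨ ×1-homo-* (suc m) (suc n) ⟩
      ι (suc m) * ι (suc n)           ≈⟨ -‿involutive _ ⟨
      - - (ι (suc m) * ι (suc n))     ≈⟨ -‿cong (-‿distribʳ-* _ _) ⟩
      - (ι (suc m) * - ι (suc n))     ≈⟨ -‿distribˡ-* _ _ ⟩
      - ι (suc m) * - ι (suc n)       ∎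

    morphism : ℤ.+-*-rawRing -Raw-AlmostCommutative⟶ fromCommutativeRing K
    morphism = record
      { ⟦_⟧    = fromℤ
      ; +-homo = +-homo
      ; *-homo = *-homo
      ; -‿homo = -‿homo
      ; 0-homo = refl
      ; 1-homo = refl
      }

    _coeff≟_ : ∀ i j → Maybe (fromℤ i ≈ fromℤ j)
    i coeff≟ j = Maybe.map (reflexive ∘ ≡.cong fromℤ) (dec⇒maybe (i ℤ.≟ j))

  open import Algebra.Solver.Ring ℤ.+-*-rawRing (fromCommutativeRing K) morphism _coeff≟_
    public using (Polynomial; solve; _:=_; _:+_; _:*_; _:-_; :-_; con)

  :0 :1 : ∀ {n} → Polynomial n
  :0 = con (+ 0)
  :1 = con (+ 1)

-- Matrix-vector algebra and elimination.

module MatrixAlgebra {c ℓ} (K : CommutativeRing c ℓ) where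
  open CommutativeRing K hiding (zero)
  open IntegerRingSolver K
  open import Algebra.Properties.Semiring.Sum semiring
    using (sum; sum-cong-≋; ∑-distrib-+; ∑-comm; *-distribˡ-sum; *-distribʳ-sum;
           sum-replicate-zero)
  open import Relation.Binary.Reasoning.Setoid setoid

  Mat : ℕ → ℕ → Set c
  Mat m n = Fin m → Fin n → Carrier

  infix  4 _≋_
  infixr 7 _∙_

  _≋_ : ∀ {n} → Vector Carrier n → Vector Carrier n → Set ℓ
  x ≋ y = ∀ i → x i ≈ y i

  _∙_ : ∀ {m n} → Mat m n → Vector Carrier n → Vector Carrier m
  (A ∙ x) i = sum λ j → A i j * x j

  -- The BLAS operation. It merges addition and scaling, so one linearity law per side covers
  -- differences, row operations and points on a line.
  axpy : ∀ {n} → Vector Carrier n → Carrier → Vector Carrier n → Vector Carrier n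
  axpy x a y i = x i + a * y i

  sum-axpy : ∀ {n} (x : Vector Carrier n) a y → sum (axpy x a y) ≈ sum x + a * sum y
  sum-axpy x a y = begin
    sum (axpy x a y)                     ≈⟨ ∑-distrib-+ x _ ⟩
    sum x + sum (λ i → a * y i)          ≈⟨ +-congˡ (*-distribˡ-sum a y) ⟨
    sum x + a * sum y                    ∎

  sum-δ : ∀ {n} (d x : Vector Carrier n) i →
          sum (λ j → (if does (i Fin.≟ j) then d i else 0#) * x j) ≈ d i * x i
  sum-δ {suc n} d x zero    = begin
    d zero * x zero + sum (λ j → 0# * x (suc j))  ≈⟨ +-congˡ (sum-cong-≋ {n} λ j → zeroˡ _) ⟩
    d zero * x zero + sum {n} (λ j → 0#)          ≈⟨ +-congˡ (sum-replicate-zero n) ⟩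
    d zero * x zero + 0#                          ≈⟨ +-identityʳ _ ⟩
    d zero * x zero                               ∎
  -- `does (suc i ≟ suc j)` reduces to `does (i ≟ j)`, so the induction hypothesis applies as it
  -- stands.
  sum-δ {suc n} d x (suc i) = begin
    0# * x zero + sum (λ j → (if does (i Fin.≟ j) then d (suc i) else 0#) * x (suc j))
      ≈⟨ +-cong (zeroˡ _) (sum-δ (d ∘ suc) (x ∘ suc) i) ⟩
    0# + d (suc i) * x (suc i)
      ≈⟨ +-identityˡ _ ⟩
    d (suc i) * x (suc i) ∎

  ∙-congˡ : ∀ {m n} (A : Mat m n) {x y} → x ≋ y → A ∙ x ≋ A ∙ y
  ∙-congˡ {n = n} A x≋y i = sum-cong-≋ {n} λ j → *-congˡ (x≋y j)

  ∙-zeroʳ : ∀ {m n} (A : Mat m n) {x} → x ≋ (λ _ → 0#) → A ∙ x ≋ λ _ → 0#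
  ∙-zeroʳ {n = n} A x≋0 i =
    trans (sum-cong-≋ {n} λ j → trans (*-congˡ (x≋0 j)) (zeroʳ _)) (sum-replicate-zero n)

  ∙-axpyʳ : ∀ {m n} (A : Mat m n) x a y → A ∙ axpy x a y ≋ axpy (A ∙ x) a (A ∙ y)
  ∙-axpyʳ {n = n} A x a y i = begin
    sum (λ j → A i j * (x j + a * y j))
      ≈⟨ sum-cong-≋ {n} (λ j → solve 4 (λ m x a y → m :* (x :+ a :* y) := m :* x :+ a :* (m :* y))
                                 refl (A i j) (x j) a (y j)) ⟩
    sum (axpy (λ j → A i j * x j) a (λ j → A i j * y j))
      ≈⟨ sum-axpy {n} _ a _ ⟩
    (A ∙ x) i + a * (A ∙ y) i ∎

  -- The scalar may vary with the row, as the row operation that builds `L⁺` requires.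
  axpy-∙ : ∀ {m n} (A B : Mat m n) (a : Vector Carrier m) x →
           (λ i → axpy (A i) (a i) (B i)) ∙ x ≋ λ i → (A ∙ x) i + a i * (B ∙ x) i
  axpy-∙ {n = n} A B a x i = begin
    sum (λ j → (A i j + a i * B i j) * x j)
      ≈⟨ sum-cong-≋ {n} (λ j → solve 4 (λ m a n x → (m :+ a :* n) :* x := m :* x :+ a :* (n :* x))
                                 refl (A i j) (a i) (B i j) (x j)) ⟩
    sum (axpy (λ j → A i j * x j) (a i) (λ j → B i j * x j))
      ≈⟨ sum-axpy {n} _ (a i) _ ⟩
    (A ∙ x) i + a i * (B ∙ x) i ∎

  ∙-assoc : ∀ {l m n} (A : Mat l m) (B : Mat m n) x →
            (λ i k → sum λ j → A i j * B j k) ∙ x ≋ A ∙ B ∙ x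
  ∙-assoc {m = m} {n} A B x i = begin
    sum (λ k → sum (λ j → A i j * B j k) * x k)
      ≈⟨ sum-cong-≋ {n} (λ k → *-distribʳ-sum {m} (x k) _) ⟩
    sum (λ k → sum λ j → A i j * B j k * x k)
      ≈⟨ ∑-comm {n} {m} _ ⟩
    sum (λ j → sum λ k → A i j * B j k * x k)
      ≈⟨ sum-cong-≋ {m} (λ j → sum-cong-≋ {n} λ k → *-assoc (A i j) (B j k) (x k)) ⟩
    sum (λ j → sum λ k → A i j * (B j k * x k))
      ≈⟨ sum-cong-≋ {m} (λ j → *-distribˡ-sum {n} (A i j) _) ⟨
    sum (λ j → A i j * (B ∙ x) j) ∎

  module _ (_≟_ : Decidable _≈_) (0≉1 : ¬ (0# ≈ 1#))
           (inverse : ∀ x → ¬ (x ≈ 0#) → ∃ λ y → x * y ≈ 1#) where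

    HasKernel : ∀ {m n} → Mat m n → Set _
    HasKernel A = ∃ λ v → ¬ (v ≋ λ _ → 0#) × A ∙ v ≋ λ _ → 0#

    HasLeftInverse : ∀ {m n} → Mat m n → Set _
    HasLeftInverse A = ∃ λ L → ∀ x → L ∙ A ∙ x ≋ x

    -- Induction on the columns: if L inverts the tail A′ on the left, then the
    -- head column c₀ is independent of A′ iff w = c₀ − A′ L c₀ is nonzero, and a
    -- nonzero coordinate of y − A′ L y is a functional separating c₀ from A′.

    kernel⊎leftInverse : ∀ {m n} (A : Mat m n) → HasKernel A ⊎ HasLeftInverse A
    kernel⊎leftInverse {n = zero}  A = inj₂ ((λ ()) , λ _ ())
    kernel⊎leftInverse {m} {suc n} A with kernel⊎leftInverse (tail ∘ A)
    ... | inj₁ (v , v≉0 , A′v≈0) =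
      inj₁ (0# ∷ v , (λ eq → v≉0 (eq ∘ suc)) ,
            λ i → trans (+-cong (zeroʳ _) (A′v≈0 i)) (+-identityˡ 0#))
    ... | inj₂ (L , L∙A′) = go (Fin.all? λ p → w p ≟ 0#)
      where
      c₀ = head ∘ A
      A′ = tail ∘ A
      b = L ∙ c₀
      w = axpy c₀ (- 1#) (A′ ∙ b)

      go : _ → HasKernel A ⊎ HasLeftInverse A
      go (yes w≈0) = inj₁ (v , v≉0 , λ i → trans (Av≈w i) (w≈0 i))
        where
        -- A vanishing `w` means `c₀ = A′ b`, so `(1, - b)` is in the kernel.
        v = 1# ∷ axpy (λ _ → 0#) (- 1#) b

        v≉0 : ¬ (v ≋ λ _ → 0#)
        v≉0 v≈0 = 0≉1 (sym (v≈0 zero))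

        Av≈w : A ∙ v ≋ w
        Av≈w i = begin
          c₀ i * 1# + (A′ ∙ axpy (λ _ → 0#) (- 1#) b) i
            ≈⟨ +-cong (*-identityʳ _) (∙-axpyʳ A′ _ _ b i) ⟩
          c₀ i + ((A′ ∙ λ _ → 0#) i + - 1# * (A′ ∙ b) i)
            ≈⟨ +-congˡ (+-congʳ (∙-zeroʳ A′ (λ _ → refl) i)) ⟩
          c₀ i + (0# + - 1# * (A′ ∙ b) i)
            ≈⟨ +-congˡ (+-identityˡ _) ⟩
          w i ∎
      go (no ¬w≈0) with Fin.¬∀⟶∃¬ m _ (λ p → w p ≟ 0#) ¬w≈0
      ... | p , wₚ≉0 with inverse (w p) wₚ≉0
      ...   | u , wₚu≈1 = inj₂ (L⁺ , L⁺∙A)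
        where
        E : Mat m m
        E i j = if does (i Fin.≟ j) then 1# else 0#

        E∙ : ∀ x → E ∙ x ≋ x
        E∙ x i = trans (sum-δ (λ _ → 1#) x i) (*-identityˡ _)

        R : Mat m m
        R i = axpy (E i) (- 1#) λ k → sum λ j → A′ i j * L j k

        R∙ : ∀ y → R ∙ y ≋ axpy y (- 1#) (A′ ∙ L ∙ y)
        R∙ y i = trans (axpy-∙ E (λ i k → sum λ j → A′ i j * L j k) (λ _ → - 1#) y i)
                       (+-cong (E∙ y i) (*-congˡ (∙-assoc A′ L y i)))

        -- Every row of `R = E - A′ L` kills the columns of `A′`, because `L A′` is the identity.
        -- Row `p` takes the value `w p` on `c₀`, and `u` normalises this to 1.
        φ : Vector Carrier m
        φ k = u * R p k

        φ∙ : ∀ y → sum (λ k → φ k * y k) ≈ u * (y p + - 1# * (A′ ∙ L ∙ y) p)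
        φ∙ y = begin
          sum (λ k → u * R p k * y k)     ≈⟨ sum-cong-≋ {m} (λ k → *-assoc u (R p k) (y k)) ⟩
          sum (λ k → u * (R p k * y k))   ≈⟨ *-distribˡ-sum {m} u _ ⟨
          u * (R ∙ y) p                   ≈⟨ *-congˡ (R∙ y p) ⟩
          u * (y p + - 1# * (A′ ∙ L ∙ y) p) ∎

        -- `φ` reads off `x₀` from `A x`, while `L A x = x′ + x₀ b`; subtracting `b j` times `φ`
        -- from row `j` of `L` leaves `x′`.
        L⁺ : Mat (suc n) m
        L⁺ = φ ∷ λ j → axpy (L j) (- b j) φ

        module _ (x : Vector Carrier (suc n)) where
          x₀ = head x
          x′ = tail x

          A∙x : A ∙ x ≋ axpy (A′ ∙ x′) x₀ c₀
          A∙x i = trans (+-comm _ _) (+-congˡ (*-comm _ _))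

          L∙A∙x : L ∙ A ∙ x ≋ axpy x′ x₀ b
          L∙A∙x i = begin
            (L ∙ A ∙ x) i                   ≈⟨ ∙-congˡ L A∙x i ⟩
            (L ∙ axpy (A′ ∙ x′) x₀ c₀) i     ≈⟨ ∙-axpyʳ L _ x₀ c₀ i ⟩
            (L ∙ A′ ∙ x′) i + x₀ * b i      ≈⟨ +-congʳ (L∙A′ x′ i) ⟩
            x′ i + x₀ * b i                 ∎

          φ∙A∙x : sum (λ k → φ k * (A ∙ x) k) ≈ x₀
          φ∙A∙x = begin
            sum (λ k → φ k * (A ∙ x) k)
              ≈⟨ φ∙ (A ∙ x) ⟩
            u * ((A ∙ x) p + - 1# * (A′ ∙ L ∙ A ∙ x) p)
              ≈⟨ *-congˡ (+-cong (A∙x p) (*-congˡ (trans (∙-congˡ A′ L∙A∙x p) (∙-axpyʳ A′ x′ x₀ b p)))) ⟩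
            u * ((A′ ∙ x′) p + x₀ * c₀ p + - 1# * ((A′ ∙ x′) p + x₀ * (A′ ∙ b) p))
              ≈⟨ solve 5 (λ u x₀ z c₀ d →
                   u :* (z :+ x₀ :* c₀ :+ :- :1 :* (z :+ x₀ :* d)) := x₀ :* ((c₀ :+ :- :1 :* d) :* u))
                   refl u x₀ ((A′ ∙ x′) p) (c₀ p) ((A′ ∙ b) p) ⟩
            x₀ * (w p * u)   ≈⟨ *-congˡ wₚu≈1 ⟩
            x₀ * 1#          ≈⟨ *-identityʳ _ ⟩
            x₀ ∎

          L⁺∙A : L⁺ ∙ A ∙ x ≋ x
          L⁺∙A zero    = φ∙A∙x
          L⁺∙A (suc j) = begin
            (L⁺ ∙ A ∙ x) (suc j)
              ≈⟨ axpy-∙ L (λ _ → φ) (λ j → - b j) (A ∙ x) j ⟩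
            (L ∙ A ∙ x) j + - b j * sum (λ k → φ k * (A ∙ x) k)
              ≈⟨ +-cong (L∙A∙x j) (*-congˡ φ∙A∙x) ⟩
            x′ j + x₀ * b j + - b j * x₀
              ≈⟨ solve 3 (λ x x₀ b → x :+ x₀ :* b :+ :- b :* x₀ := x) refl (x′ j) x₀ (b j) ⟩
            x′ j ∎

-- Ordered-field inequalities and square roots.

module RealArithmetic {c ℓ₁ ℓ₂} (R : RealNumbers c ℓ₁ ℓ₂) where
  open RealNumbers R
  open CommutativeRing commutativeRing public
    using (refl; sym; trans; setoid; +-cong; +-congˡ; +-congʳ; *-cong; *-congˡ; *-congʳ; -‿cong;
           +-identityˡ; +-identityʳ; *-identityˡ; *-identityʳ; zeroˡ; zeroʳ; semiring;
           *-comm; +-comm; -‿inverseʳ)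
  open IsDecTotalOrder isDecTotalOrder public
    using (_≟_; antisym; total; ≤-respˡ-≈; ≤-respʳ-≈)
    renaming (refl to ≤-refl; reflexive to ≤-reflexive; trans to ≤-trans)
  open IntegerRingSolver commutativeRing public
  open import Relation.Binary.Reasoning.Setoid setoid

  infixl 9 _²
  _² : Carrier → Carrier
  x ² = x * x

  -- Splits an inequality into the sign of an explicit difference and a ring identity, the latter
  -- being what the solver can check.
  ≤-by-difference : ∀ {x y d} → 0# ≤ d → y ≈ x + d → x ≤ y
  ≤-by-difference {x} 0≤d y≈x+d =
    ≤-respʳ-≈ (sym y≈x+d) (≤-respˡ-≈ (+-identityʳ x) (+-monoʳ-≤ x 0≤d))

  x≤y⇒0≤y-x : ∀ {x y} → x ≤ y → 0# ≤ y + - x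
  x≤y⇒0≤y-x {x} {y} x≤y =
    ≤-respʳ-≈ (+-comm (- x) y) (≤-respˡ-≈ (trans (+-comm _ _) (-‿inverseʳ x)) (+-monoʳ-≤ (- x) x≤y))

  +-nonNegative : ∀ {x y} → 0# ≤ x → 0# ≤ y → 0# ≤ x + y
  +-nonNegative {x} 0≤x 0≤y = ≤-trans 0≤x (≤-by-difference 0≤y refl)

  +-mono-≤ : ∀ {x y u v} → x ≤ y → u ≤ v → x + u ≤ y + v
  +-mono-≤ {x} {y} {u} {v} x≤y u≤v =
    ≤-by-difference (+-nonNegative (x≤y⇒0≤y-x x≤y) (x≤y⇒0≤y-x u≤v))
      (solve 4 (λ x y u v → y :+ v := x :+ u :+ (y :- x :+ (v :- u))) refl x y u v)

  *-monoˡ-≤-nonNeg : ∀ {a x y} → 0# ≤ a → x ≤ y → a * x ≤ a * y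
  *-monoˡ-≤-nonNeg {a} {x} {y} 0≤a x≤y =
    ≤-by-difference (*-nonNegative 0≤a (x≤y⇒0≤y-x x≤y))
      (solve 3 (λ a x y → a :* y := a :* x :+ a :* (y :- x)) refl a x y)

  ²-nonNegative : ∀ x → 0# ≤ x ²
  ²-nonNegative x with total 0# x
  ... | inj₁ 0≤x = *-nonNegative 0≤x 0≤x
  ... | inj₂ x≤0 = ≤-respʳ-≈ (solve 1 (λ x → :- x :* :- x := x :* x) refl x) (*-nonNegative 0≤-x 0≤-x)
    where 0≤-x = ≤-respʳ-≈ (+-identityˡ _) (x≤y⇒0≤y-x x≤0)

  0≤1 : 0# ≤ 1#
  0≤1 = ≤-respʳ-≈ (*-identityʳ 1#) (²-nonNegative 1#)

  0<1 : 0# < 1#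
  0<1 = 0≤1 , 0≉1

  <⇒≱ : ∀ {x y} → x < y → ¬ (y ≤ x)
  <⇒≱ (x≤y , x≉y) y≤x = x≉y (antisym x≤y y≤x)

  0<x⇒x≉0 : ∀ {x} → 0# < x → ¬ (x ≈ 0#)
  0<x⇒x≉0 (_ , 0≉x) x≈0 = 0≉x (sym x≈0)

  0<1+nonNeg : ∀ {d e} → 0# ≤ d → e ≈ 1# + d → 0# < e
  0<1+nonNeg {d} {e} 0≤d e≈1+d = ≤-trans 0≤1 1≤e , λ 0≈e → <⇒≱ 0<1 (≤-respʳ-≈ (sym 0≈e) 1≤e)
    where
    1≤e : 1# ≤ e
    1≤e = ≤-by-difference 0≤d e≈1+d

  -- The inverse `b` equals `a * b ²`, a product of nonnegative factors.
  inverse-pos : ∀ {a} → 0# < a → ∃ λ b → (0# < b) × (a * b ≈ 1#)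
  inverse-pos {a} 0<a@(0≤a , _) with inverse a (0<x⇒x≉0 0<a)
  ... | b , ab≈1 = b , (0≤b , 0≉b) , ab≈1
    where
    0≤b : 0# ≤ b
    0≤b = ≤-respʳ-≈
      (begin
        a * b ²      ≈⟨ solve 2 (λ a b → a :* (b :* b) := a :* b :* b) refl a b ⟩
        a * b * b    ≈⟨ *-congʳ ab≈1 ⟩
        1# * b       ≈⟨ *-identityˡ b ⟩
        b            ∎)
      (*-nonNegative 0≤a (²-nonNegative b))
    0≉b : ¬ (0# ≈ b)
    0≉b 0≈b = 0≉1 (trans (sym (zeroʳ a)) (trans (*-congˡ 0≈b) ab≈1))

  *-cancelˡ-≤-pos : ∀ {a x y} → 0# < a → a * x ≤ a * y → x ≤ y
  *-cancelˡ-≤-pos {a} {x} {y} 0<a ax≤ay with inverse-pos 0<a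
  ... | b , (0≤b , _) , ab≈1 =
    ≤-respˡ-≈ (cancel x) (≤-respʳ-≈ (cancel y) (*-monoˡ-≤-nonNeg 0≤b ax≤ay))
    where
    cancel : ∀ z → b * (a * z) ≈ z
    cancel z = begin
      b * (a * z)   ≈⟨ solve 3 (λ a b z → b :* (a :* z) := a :* b :* z) refl a b z ⟩
      a * b * z     ≈⟨ *-congʳ ab≈1 ⟩
      1# * z        ≈⟨ *-identityˡ z ⟩
      z             ∎

  *-cancelʳ-≤-pos : ∀ {a x y} → 0# < a → x * a ≤ y * a → x ≤ y
  *-cancelʳ-≤-pos {a} {x} {y} 0<a xa≤ya = *-cancelˡ-≤-pos 0<a
    (≤-respˡ-≈ (*-comm x a) (≤-respʳ-≈ (*-comm y a) xa≤ya))

  x²≈0⇒x≈0 : ∀ {x} → x ² ≈ 0# → x ≈ 0#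
  x²≈0⇒x≈0 {x} x²≈0 with x ≟ 0#
  ... | yes x≈0 = x≈0
  ... | no  x≉0 with inverse x x≉0
  ...   | y , xy≈1 = begin
    x             ≈⟨ *-identityʳ x ⟨
    x * 1#        ≈⟨ *-congˡ xy≈1 ⟨
    x * (x * y)   ≈⟨ solve 2 (λ x y → x :* (x :* y) := x :* x :* y) refl x y ⟩
    x ² * y       ≈⟨ *-congʳ x²≈0 ⟩
    0# * y        ≈⟨ zeroˡ y ⟩
    0#            ∎

  nonNeg-sum≤0 : ∀ {x y} → 0# ≤ x → 0# ≤ y → x + y ≤ 0# → x ≈ 0# × y ≈ 0#
  nonNeg-sum≤0 {x} {y} 0≤x 0≤y x+y≤0 =
    antisym (≤-trans (≤-by-difference 0≤y refl) x+y≤0) 0≤x ,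
    antisym (≤-trans (≤-by-difference 0≤x (+-comm x y)) x+y≤0) 0≤y

  -- In the case `y ≤ x`, put `d = x - y`. Then `x² - y² = d² + 2 y d` is at most 0 with both
  -- summands nonnegative, which forces `d = 0`.
  ²-cancel-≤ : ∀ {x y} → 0# ≤ y → x ² ≤ y ² → x ≤ y
  ²-cancel-≤ {x} {y} 0≤y x²≤y² with total x y
  ... | inj₁ x≤y = x≤y
  ... | inj₂ y≤x = ≤-reflexive x≈y
    where
    d = x + - y
    0≤d = x≤y⇒0≤y-x y≤x
    sum≤0 : d ² + (y * d + y * d) ≤ 0#
    sum≤0 = ≤-by-difference (x≤y⇒0≤y-x x²≤y²)
      (solve 2 (λ x y → :0 := (x :- y) :* (x :- y) :+ (y :* (x :- y) :+ y :* (x :- y))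
                                     :+ (y :* y :- x :* x))
        refl x y)
    d≈0 : d ≈ 0#
    d≈0 = x²≈0⇒x≈0 (proj₁ (nonNeg-sum≤0 (²-nonNegative d)
      (+-nonNegative (*-nonNegative 0≤y 0≤d) (*-nonNegative 0≤y 0≤d)) sum≤0))
    x≈y : x ≈ y
    x≈y = trans (solve 2 (λ x y → x := x :- y :+ y) refl x y)
                (trans (+-congʳ d≈0) (+-identityˡ y))

  x≤[x+1]² : ∀ {x} → 0# ≤ x → x ≤ (x + 1#) ²
  x≤[x+1]² {x} 0≤x =
    ≤-by-difference (+-nonNegative (+-nonNegative (²-nonNegative x) 0≤x) (²-nonNegative 1#))
      (solve 1 (λ x → (x :+ :1) :* (x :+ :1) := x :+ (x :* x :+ x :+ :1 :* :1)) refl x)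

  -- The Möbius map t = (k σ + s) / (σ + k) with k = s + 1 moves every σ ≥ 0
  -- towards √s without crossing it; v stands for 1 / (σ + k).

  module SqrtStep {s σ v} (0≤s : 0# ≤ s) (0≤σ : 0# ≤ σ) (v[σ+k]≈1 : (σ + (s + 1#)) * v ≈ 1#)
                  (0≤v : 0# ≤ v) where
    k e t : Carrier
    -- The summand 1 serves twice: it gives `k² ≥ s`, which fixes the sign in `s-t²`, and it keeps
    -- `σ + k` positive even when `s = σ = 0`.
    k = s + 1#
    e = σ + k
    t = (k * σ + s) * v

    0≤k : 0# ≤ k
    0≤k = +-nonNegative 0≤s 0≤1

    0≤e : 0# ≤ e
    0≤e = +-nonNegative 0≤σ 0≤k

    0≤t : 0# ≤ t
    0≤t = *-nonNegative (+-nonNegative (*-nonNegative 0≤k 0≤σ) 0≤s) 0≤v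

    private
      0≤v²[k²-s] : 0# ≤ v ² * (k ² + - s)
      0≤v²[k²-s] = *-nonNegative (²-nonNegative v) (x≤y⇒0≤y-x (x≤[x+1]² 0≤s))

      te≈ : e * t ≈ k * σ + s
      te≈ = begin
        e * ((k * σ + s) * v)
          ≈⟨ solve 3 (λ z v e → e :* (z :* v) := z :* (e :* v)) refl (k * σ + s) v e ⟩
        (k * σ + s) * (e * v)
          ≈⟨ *-congˡ v[σ+k]≈1 ⟩
        (k * σ + s) * 1#
          ≈⟨ *-identityʳ _ ⟩
        k * σ + s ∎

      -- After cancelling `v²` this is `s (σ + k)² - (k σ + s)² = (k² - s) (s -
      -- σ²)`: the step preserves the side of `√s` on which `σ` lies.
      identity : ∀ s k σ v → s * ((σ + k) * v) ² ≈
                 ((k * σ + s) * v) ² + v ² * (k ² + - s) * (s + - σ ²)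
      identity = solve 4 (λ s k σ v → s :* ((σ :+ k) :* v :* ((σ :+ k) :* v))
        := (k :* σ :+ s) :* v :* ((k :* σ :+ s) :* v) :+ v :* v :* (k :* k :- s) :* (s :- σ :* σ)) refl

      s-t² : s ≈ t ² + v ² * (k ² + - s) * (s + - σ ²)
      s-t² = begin
        s                     ≈⟨ *-identityʳ s ⟨
        s * 1#                ≈⟨ *-congˡ (*-identityʳ 1#) ⟨
        s * 1# ²              ≈⟨ *-congˡ (*-cong v[σ+k]≈1 v[σ+k]≈1) ⟨
        s * (e * v) ²         ≈⟨ identity s k σ v ⟩
        t ² + v ² * (k ² + - s) * (s + - σ ²) ∎

    σ²≤s⇒t²≤s : σ ² ≤ s → t ² ≤ s
    σ²≤s⇒t²≤s σ²≤s = ≤-by-difference (*-nonNegative 0≤v²[k²-s] (x≤y⇒0≤y-x σ²≤s)) s-t²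

    s≤σ²⇒s≤t² : s ≤ σ ² → s ≤ t ²
    s≤σ²⇒s≤t² s≤σ² = ≤-by-difference (*-nonNegative 0≤v²[k²-s] (x≤y⇒0≤y-x s≤σ²))
      (trans (rearrange (t ²) (v ² * (k ² + - s)) s (σ ²)) (+-congʳ (sym s-t²)))
      where
      rearrange : ∀ q a s r → q ≈ (q + a * (s + - r)) + a * (r + - s)
      rearrange = solve 4 (λ q a s r → q := (q :+ a :* (s :- r)) :+ a :* (r :- s)) refl

    -- From `te≈`, `e (t - σ) = s - σ²`, so the direction in which the step moves `σ` decides the
    -- comparison of `σ²` with `s`.
    t≤σ⇒s≤σ² : t ≤ σ → s ≤ σ ²
    t≤σ⇒s≤σ² t≤σ = ≤-by-difference
      (x≤y⇒0≤y-x (≤-respˡ-≈ te≈ (*-monoˡ-≤-nonNeg 0≤e t≤σ)))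
      (solve 3 (λ σ k s → σ :* σ := s :+ ((σ :+ k) :* σ :- (k :* σ :+ s))) refl σ k s)

    σ≤t⇒σ²≤s : σ ≤ t → σ ² ≤ s
    σ≤t⇒σ²≤s σ≤t = ≤-by-difference
      (x≤y⇒0≤y-x (≤-respʳ-≈ te≈ (*-monoˡ-≤-nonNeg 0≤e σ≤t)))
      (solve 3 (λ σ k s → s := σ :* σ :+ (k :* σ :+ s :- (σ :+ k) :* σ)) refl σ k s)

  -- The lift is there because `supremum` takes predicates at one fixed level.
  SquareBelow : Carrier → Carrier → Set (c ⊔ ℓ₁ ⊔ ℓ₂)
  SquareBelow s r = Lift (c ⊔ ℓ₁ ⊔ ℓ₂) (r ² ≤ s)

  0-squareBelow : ∀ {s} → 0# ≤ s → SquareBelow s 0#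
  0-squareBelow 0≤s = lift (≤-respˡ-≈ (sym (zeroˡ 0#)) 0≤s)

  -- If `σ² ≤ s`, the step `t` is again in the set, so `t ≤ σ`, which forces `s ≤ σ²`. If `s ≤ σ²`,
  -- then `t` is an upper bound, so `σ ≤ t`, which forces `σ² ≤ s`. The step replaces the usual
  -- choice of a small epsilon.
  supremum-squareBelow : ∀ {s σ} → 0# ≤ s → IsSupremum (SquareBelow s) σ → σ ² ≈ s
  supremum-squareBelow {s} {σ} 0≤s (upper , least) = go (inverse-pos 0<σ+k)
    where
    0≤σ = upper 0# (0-squareBelow 0≤s)

    0<σ+k : 0# < σ + (s + 1#)
    0<σ+k = 0<1+nonNeg (+-nonNegative 0≤σ 0≤s)
      (solve 2 (λ σ s → σ :+ (s :+ :1) := :1 :+ (σ :+ s)) refl σ s)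

    go : (∃ λ v → (0# < v) × ((σ + (s + 1#)) * v ≈ 1#)) → σ ² ≈ s
    go (v , (0≤v , _) , [σ+k]v≈1) with total (σ ²) s
    ... | inj₁ σ²≤s = antisym σ²≤s (t≤σ⇒s≤σ² (upper t (lift (σ²≤s⇒t²≤s σ²≤s))))
      where open SqrtStep 0≤s 0≤σ [σ+k]v≈1 0≤v
    ... | inj₂ s≤σ² = antisym (σ≤t⇒σ²≤s (least t λ r r²≤s →
                        ²-cancel-≤ 0≤t (≤-trans (lower r²≤s) (s≤σ²⇒s≤t² s≤σ²)))) s≤σ²
      where open SqrtStep 0≤s 0≤σ [σ+k]v≈1 0≤v

  sqrt : ∀ {s} → 0# ≤ s → ∃ λ σ → (0# ≤ σ) × (σ ² ≈ s)
  sqrt {s} 0≤s = go (supremum (SquareBelow s) (0# , 0-squareBelow 0≤s) (s + 1# , bounded))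
    where
    bounded : ∀ r → SquareBelow s r → r ≤ s + 1#
    bounded r (lift r²≤s) = ²-cancel-≤ (+-nonNegative 0≤s 0≤1) (≤-trans r²≤s (x≤[x+1]² 0≤s))

    go : ∃ (IsSupremum (SquareBelow s)) → ∃ λ σ → (0# ≤ σ) × (σ ² ≈ s)
    go (σ , isSup) = σ , proj₁ isSup 0# (0-squareBelow 0≤s) , supremum-squareBelow 0≤s isSup

-- Complex vectors as a real inner product space.

module ComplexInnerProduct {c ℓ₁ ℓ₂} (R : RealNumbers c ℓ₁ ℓ₂) where
  open ComplexMatrices R

  module ℝ where
    open RealNumbers R public
    open RealArithmetic R public

  open ℝ using (_²; solve; _:=_; _:+_; _:*_; _:-_; :-_; :0; :1)
  module ℝΣ = SemiringSum ℝ.semiring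
  open import Relation.Binary.Reasoning.Setoid ℝ.setoid

  -- Built on the operations of `ComplexMatrices` themselves, so that `_∙_` and `_*ᵥ_` coincide
  -- definitionally and the generic matrix lemmas apply without conversion.
  ℂ-commutativeRing : CommutativeRing c ℓ₁
  ℂ-commutativeRing = record
    { _≈_ = _≈_ ; _+_ = _+_ ; _*_ = _*_ ; -_ = -_ ; 0# = 0# ; 1# = 1#
    ; isCommutativeRing = record
      { isRing = record
        { +-isAbelianGroup = record
          { isGroup = record
            { isMonoid = record
              { isSemigroup = record
                { isMagma = record
                  { isEquivalence = record
                    { refl  = ℝ.refl , ℝ.refl
                    ; sym   = λ (p , q) → ℝ.sym p , ℝ.sym q
                    ; trans = λ (p , q) (r , s) → ℝ.trans p r , ℝ.trans q s
                    }
                  ; ∙-cong = λ (p , q) (r , s) → ℝ.+-cong p r , ℝ.+-cong q s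
                  }
                ; assoc = λ x y z → +-assocℝ (re x) (re y) (re z) , +-assocℝ (im x) (im y) (im z)
                }
              ; identity = (λ x → ℝ.+-identityˡ (re x) , ℝ.+-identityˡ (im x))
                         , (λ x → ℝ.+-identityʳ (re x) , ℝ.+-identityʳ (im x))
              }
            ; inverse = (λ x → -‿inverseˡℝ (re x) , -‿inverseˡℝ (im x))
                      , (λ x → ℝ.-‿inverseʳ (re x) , ℝ.-‿inverseʳ (im x))
            ; ⁻¹-cong = λ (p , q) → ℝ.-‿cong p , ℝ.-‿cong q
            }
          ; comm = λ x y → ℝ.+-comm (re x) (re y) , ℝ.+-comm (im x) (im y)
          }
        ; *-cong = λ (p , q) (r , s) →
            ℝ.+-cong (ℝ.*-cong p r) (ℝ.-‿cong (ℝ.*-cong q s)) ,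
            ℝ.+-cong (ℝ.*-cong p s) (ℝ.*-cong q r)
        ; *-assoc = λ x y z →
            solve 6 (λ a b c d e f →
              (a :* c :- b :* d) :* e :- (a :* d :+ b :* c) :* f
              := a :* (c :* e :- d :* f) :- b :* (c :* f :+ d :* e)) ℝ.refl
              (re x) (im x) (re y) (im y) (re z) (im z) ,
            solve 6 (λ a b c d e f →
              (a :* c :- b :* d) :* f :+ (a :* d :+ b :* c) :* e
              := a :* (c :* f :+ d :* e) :+ b :* (c :* e :- d :* f)) ℝ.refl
              (re x) (im x) (re y) (im y) (re z) (im z)
        ; *-identity =
            (λ x → solve 2 (λ a b → :1 :* a :- :0 :* b := a) ℝ.refl (re x) (im x) ,
                   solve 2 (λ a b → :1 :* b :+ :0 :* a := b) ℝ.refl (re x) (im x)) ,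
            (λ x → solve 2 (λ a b → a :* :1 :- b :* :0 := a) ℝ.refl (re x) (im x) ,
                   solve 2 (λ a b → a :* :0 :+ b :* :1 := b) ℝ.refl (re x) (im x))
        ; distrib =
            (λ x y z →
              solve 6 (λ a b c d e f → a :* (c :+ e) :- b :* (d :+ f)
                := a :* c :- b :* d :+ (a :* e :- b :* f)) ℝ.refl
                (re x) (im x) (re y) (im y) (re z) (im z) ,
              solve 6 (λ a b c d e f → a :* (d :+ f) :+ b :* (c :+ e)
                := a :* d :+ b :* c :+ (a :* f :+ b :* e)) ℝ.refl
                (re x) (im x) (re y) (im y) (re z) (im z)) ,
            (λ x y z →
              solve 6 (λ a b c d e f → (c :+ e) :* a :- (d :+ f) :* b
                := c :* a :- d :* b :+ (e :* a :- f :* b)) ℝ.refl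
                (re x) (im x) (re y) (im y) (re z) (im z) ,
              solve 6 (λ a b c d e f → (c :+ e) :* b :+ (d :+ f) :* a
                := c :* b :+ d :* a :+ (e :* b :+ f :* a)) ℝ.refl
                (re x) (im x) (re y) (im y) (re z) (im z))
        }
      ; *-comm = λ x y →
          solve 4 (λ a b c d → a :* c :- b :* d := c :* a :- d :* b) ℝ.refl
            (re x) (im x) (re y) (im y) ,
          solve 4 (λ a b c d → a :* d :+ b :* c := c :* b :+ d :* a) ℝ.refl
            (re x) (im x) (re y) (im y)
      }
    }
    where
    open CommutativeRing ℝ.commutativeRing
      using () renaming (+-assoc to +-assocℝ; -‿inverseˡ to -‿inverseˡℝ)

  module ℂRing = CommutativeRing ℂ-commutativeRing
  open MatrixAlgebra ℂ-commutativeRing public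

  private
    variable
      m n : ℕ

  -- The real part of `z * conj w`.
  rdot : ℂ → ℂ → ℝ
  rdot z w = re z ℝ.* re w ℝ.+ im z ℝ.* im w

  ⟪_,_⟫ : Vector ℂ n → Vector ℂ n → ℝ
  ⟪ x , y ⟫ = ℝΣ.sum λ i → rdot (x i) (y i)

  ∥_∥² : Vector ℂ n → ℝ
  ∥ x ∥² = ⟪ x , x ⟫

  rdot-cong : ∀ {z z′ w w′} → z ≈ z′ → w ≈ w′ → rdot z w ℝ.≈ rdot z′ w′
  rdot-cong (p , q) (r , s) = ℝ.+-cong (ℝ.*-cong p r) (ℝ.*-cong q s)

  rdot-comm : ∀ z w → rdot z w ℝ.≈ rdot w z
  rdot-comm z w = ℝ.+-cong (ℝ.*-comm (re z) (re w)) (ℝ.*-comm (im z) (im w))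

  rdot-nonNegative : ∀ z → ℝ.0# ℝ.≤ rdot z z
  rdot-nonNegative z = ℝ.+-nonNegative (ℝ.²-nonNegative (re z)) (ℝ.²-nonNegative (im z))

  rdot-definite : ∀ z → rdot z z ℝ.≤ ℝ.0# → z ≈ 0#
  rdot-definite z z²≤0 = ℝ.x²≈0⇒x≈0 (proj₁ both) , ℝ.x²≈0⇒x≈0 (proj₂ both)
    where both = ℝ.nonNeg-sum≤0 (ℝ.²-nonNegative (re z)) (ℝ.²-nonNegative (im z)) z²≤0

  rdot-adjoint : ∀ a z w → rdot (a * z) w ℝ.≈ rdot z (conj a * w)
  rdot-adjoint a z w = solve 6 (λ a b c d e f →
    (a :* c :- b :* d) :* e :+ (a :* d :+ b :* c) :* f
    := c :* (a :* e :- :- b :* f) :+ d :* (a :* f :+ :- b :* e)) ℝ.refl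
    (re a) (im a) (re z) (im z) (re w) (im w)

  rdot-sumˡ : ∀ (f : Vector ℂ n) w → rdot (sum f) w ℝ.≈ ℝΣ.sum λ j → rdot (f j) w
  rdot-sumˡ {zero}  f w = solve 2 (λ a b → :0 :* a :+ :0 :* b := :0) ℝ.refl (re w) (im w)
  rdot-sumˡ {suc n} f w = begin
    rdot (f zero + sum (tail f)) w
      ≈⟨ solve 6 (λ a b c d e f → (a :+ c) :* e :+ (b :+ d) :* f
           := a :* e :+ b :* f :+ (c :* e :+ d :* f)) ℝ.refl
           (re (f zero)) (im (f zero)) (re (sum (tail f))) (im (sum (tail f))) (re w) (im w) ⟩
    rdot (f zero) w ℝ.+ rdot (sum (tail f)) w
      ≈⟨ ℝ.+-congˡ (rdot-sumˡ (tail f) w) ⟩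
    ℝΣ.sum (λ j → rdot (f j) w) ∎

  rdot-sumʳ : ∀ z (f : Vector ℂ n) → rdot z (sum f) ℝ.≈ ℝΣ.sum λ j → rdot z (f j)
  rdot-sumʳ {n} z f = begin
    rdot z (sum f)                    ≈⟨ rdot-comm z (sum f) ⟩
    rdot (sum f) z                    ≈⟨ rdot-sumˡ f z ⟩
    ℝΣ.sum (λ j → rdot (f j) z)       ≈⟨ ℝΣ.sum-cong-≋ {n} (λ j → rdot-comm (f j) z) ⟩
    ℝΣ.sum (λ j → rdot z (f j))       ∎

  ⟪⟫-cong : ∀ {x x′ y y′ : Vector ℂ n} → x ≈ᵛ x′ → y ≈ᵛ y′ → ⟪ x , y ⟫ ℝ.≈ ⟪ x′ , y′ ⟫
  ⟪⟫-cong {n} x≈x′ y≈y′ = ℝΣ.sum-cong-≋ {n} λ i → rdot-cong (x≈x′ i) (y≈y′ i)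

  ⟪⟫-comm : ∀ (x y : Vector ℂ n) → ⟪ x , y ⟫ ℝ.≈ ⟪ y , x ⟫
  ⟪⟫-comm {n} x y = ℝΣ.sum-cong-≋ {n} λ i → rdot-comm (x i) (y i)

  ≈ᵛ-refl : ∀ {x : Vector ℂ n} → x ≈ᵛ x
  ≈ᵛ-refl i = ℂRing.refl

  ≈ᵛ-sym : ∀ {x y : Vector ℂ n} → x ≈ᵛ y → y ≈ᵛ x
  ≈ᵛ-sym x≈y i = ℂRing.sym (x≈y i)

  ≈ᵛ-trans : ∀ {x y z : Vector ℂ n} → x ≈ᵛ y → y ≈ᵛ z → x ≈ᵛ z
  ≈ᵛ-trans x≈y y≈z i = ℂRing.trans (x≈y i) (y≈z i)

  ⟪⟫-axpyˡ : ∀ (x : Vector ℂ n) t y z →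
             ⟪ axpy x (fromℝ t) y , z ⟫ ℝ.≈ ⟪ x , z ⟫ ℝ.+ t ℝ.* ⟪ y , z ⟫
  ⟪⟫-axpyˡ {n} x t y z = begin
    ℝΣ.sum (λ i → rdot (x i + fromℝ t * y i) (z i))
      ≈⟨ ℝΣ.sum-cong-≋ {n} (λ i → solve 7 (λ t a b c d e f →
           (a :+ (t :* c :- :0 :* d)) :* e :+ (b :+ (t :* d :+ :0 :* c)) :* f
           := (a :* e :+ b :* f) :+ t :* (c :* e :+ d :* f)) ℝ.refl
           t (re (x i)) (im (x i)) (re (y i)) (im (y i)) (re (z i)) (im (z i))) ⟩
    ℝΣ.sum (λ i → rdot (x i) (z i) ℝ.+ t ℝ.* rdot (y i) (z i))
      ≈⟨ ℝMatrix.sum-axpy (λ i → rdot (x i) (z i)) t (λ i → rdot (y i) (z i)) ⟩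
    ⟪ x , z ⟫ ℝ.+ t ℝ.* ⟪ y , z ⟫ ∎
    where module ℝMatrix = MatrixAlgebra ℝ.commutativeRing

  ∥axpy∥² : ∀ (x : Vector ℂ n) t y → ∥ axpy x (fromℝ t) y ∥² ℝ.≈
            ∥ x ∥² ℝ.+ (t ℝ.* ⟪ x , y ⟫ ℝ.+ t ℝ.* ⟪ x , y ⟫) ℝ.+ t ² ℝ.* ∥ y ∥²
  ∥axpy∥² x t y = begin
    ⟪ z , z ⟫
      ≈⟨ ⟪⟫-axpyˡ x t y z ⟩
    ⟪ x , z ⟫ ℝ.+ t ℝ.* ⟪ y , z ⟫
      ≈⟨ ℝ.+-cong (flip x) (ℝ.*-congˡ (flip y)) ⟩
    (⟪ x , x ⟫ ℝ.+ t ℝ.* ⟪ y , x ⟫) ℝ.+ t ℝ.* (⟪ x , y ⟫ ℝ.+ t ℝ.* ⟪ y , y ⟫)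
      ≈⟨ ℝ.+-congʳ (ℝ.+-congˡ (ℝ.*-congˡ (⟪⟫-comm y x))) ⟩
    (⟪ x , x ⟫ ℝ.+ t ℝ.* ⟪ x , y ⟫) ℝ.+ t ℝ.* (⟪ x , y ⟫ ℝ.+ t ℝ.* ⟪ y , y ⟫)
      ≈⟨ solve 4 (λ a b c t → a :+ t :* b :+ t :* (b :+ t :* c)
           := a :+ (t :* b :+ t :* b) :+ t :* t :* c) ℝ.refl ∥ x ∥² ⟪ x , y ⟫ ∥ y ∥² t ⟩
    ∥ x ∥² ℝ.+ (t ℝ.* ⟪ x , y ⟫ ℝ.+ t ℝ.* ⟪ x , y ⟫) ℝ.+ t ² ℝ.* ∥ y ∥² ∎
    where
    z = axpy x (fromℝ t) y
    flip : ∀ w → ⟪ w , z ⟫ ℝ.≈ ⟪ x , w ⟫ ℝ.+ t ℝ.* ⟪ y , w ⟫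
    flip w = ℝ.trans (⟪⟫-comm w z) (⟪⟫-axpyˡ x t y w)

  ∥∥²-nonNegative : ∀ (x : Vector ℂ n) → ℝ.0# ℝ.≤ ∥ x ∥²
  ∥∥²-nonNegative {zero}  x = ℝ.≤-refl
  ∥∥²-nonNegative {suc n} x = ℝ.+-nonNegative (rdot-nonNegative (x zero)) (∥∥²-nonNegative (tail x))

  ∥∥²-definite : ∀ {x : Vector ℂ n} → ∥ x ∥² ℝ.≤ ℝ.0# → x ≈ᵛ 0ᵛ
  ∥∥²-definite {suc n} {x} ∥x∥²≤0 = λ where
      zero    → rdot-definite (x zero) (ℝ.≤-reflexive (proj₁ both))
      (suc i) → ∥∥²-definite {x = tail x} (ℝ.≤-reflexive (proj₂ both)) i
    where both = ℝ.nonNeg-sum≤0 (rdot-nonNegative (x zero)) (∥∥²-nonNegative (tail x)) ∥x∥²≤0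

  ∥∥²-positive : ∀ {x : Vector ℂ n} → ¬ (x ≈ᵛ 0ᵛ) → ℝ.0# ℝ.< ∥ x ∥²
  ∥∥²-positive {x = x} x≉0 =
    ∥∥²-nonNegative x , λ 0≈∥x∥² → x≉0 (∥∥²-definite (ℝ.≤-reflexive (ℝ.sym 0≈∥x∥²)))

  infixl 6 _⊝_
  -- Written as an `axpy` with a real scalar so that the bilinear expansions of the inner product
  -- and the norm apply to differences.
  _⊝_ : Vector ℂ n → Vector ℂ n → Vector ℂ n
  x ⊝ y = axpy x (fromℝ (ℝ.- ℝ.1#)) y

  x⊝y≈0⇒x≈y : ∀ {x y : Vector ℂ n} → x ⊝ y ≈ᵛ 0ᵛ → x ≈ᵛ y
  x⊝y≈0⇒x≈y {x = x} {y} x⊝y≈0 i =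
    ℝ.trans (solve 3 (λ a c d → a := (a :+ (:- :1 :* c :- :0 :* d)) :+ c) ℝ.refl
                  (re (x i)) (re (y i)) (im (y i)))
            (ℝ.trans (ℝ.+-congʳ (proj₁ (x⊝y≈0 i))) (ℝ.+-identityˡ _)) ,
    ℝ.trans (solve 3 (λ b c d → b := (b :+ (:- :1 :* d :+ :0 :* c)) :+ d) ℝ.refl
                  (im (x i)) (re (y i)) (im (y i)))
            (ℝ.trans (ℝ.+-congʳ (proj₂ (x⊝y≈0 i))) (ℝ.+-identityˡ _))

  x≈y⇒x⊝y≈0 : ∀ {x y : Vector ℂ n} → x ≈ᵛ y → x ⊝ y ≈ᵛ 0ᵛ
  x≈y⇒x⊝y≈0 {x = x} {y} x≈y i =
    ℝ.trans (ℝ.+-congʳ (proj₁ (x≈y i)))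
            (solve 2 (λ c d → c :+ (:- :1 :* c :- :0 :* d) := :0) ℝ.refl (re (y i)) (im (y i))) ,
    ℝ.trans (ℝ.+-congʳ (proj₂ (x≈y i)))
            (solve 2 (λ c d → d :+ (:- :1 :* d :+ :0 :* c) := :0) ℝ.refl (re (y i)) (im (y i)))

  -- Testing against `x ⊝ y` itself makes its norm vanish.
  ⟪⟫-nondegenerate : ∀ {x y : Vector ℂ n} → (∀ z → ⟪ x , z ⟫ ℝ.≈ ⟪ y , z ⟫) → x ≈ᵛ y
  ⟪⟫-nondegenerate {x = x} {y} eq = x⊝y≈0⇒x≈y (∥∥²-definite (ℝ.≤-reflexive (begin
    ⟪ x ⊝ y , x ⊝ y ⟫
      ≈⟨ ⟪⟫-axpyˡ x (ℝ.- ℝ.1#) y (x ⊝ y) ⟩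
    ⟪ x , x ⊝ y ⟫ ℝ.+ ℝ.- ℝ.1# ℝ.* ⟪ y , x ⊝ y ⟫
      ≈⟨ ℝ.+-congʳ (eq (x ⊝ y)) ⟩
    ⟪ y , x ⊝ y ⟫ ℝ.+ ℝ.- ℝ.1# ℝ.* ⟪ y , x ⊝ y ⟫
      ≈⟨ solve 1 (λ a → a :+ :- :1 :* a := :0) ℝ.refl ⟪ y , x ⊝ y ⟫ ⟩
    ℝ.0# ∎)))

  ⟪⟫-adjoint : ∀ (A : Matrix n) x y → ⟪ A *ᵥ x , y ⟫ ℝ.≈ ⟪ x , A ᴴ *ᵥ y ⟫
  ⟪⟫-adjoint {n} A x y = begin
    ℝΣ.sum (λ i → rdot (sum λ j → A i j * x j) (y i))
      ≈⟨ ℝΣ.sum-cong-≋ {n} (λ i → rdot-sumˡ (λ j → A i j * x j) (y i)) ⟩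
    ℝΣ.sum (λ i → ℝΣ.sum λ j → rdot (A i j * x j) (y i))
      ≈⟨ ℝΣ.∑-comm {n} {n} _ ⟩
    ℝΣ.sum (λ j → ℝΣ.sum λ i → rdot (A i j * x j) (y i))
      ≈⟨ ℝΣ.sum-cong-≋ {n} (λ j → ℝΣ.sum-cong-≋ {n} λ i → rdot-adjoint (A i j) (x j) (y i)) ⟩
    ℝΣ.sum (λ j → ℝΣ.sum λ i → rdot (x j) (conj (A i j) * y i))
      ≈⟨ ℝΣ.sum-cong-≋ {n} (λ j → rdot-sumʳ (x j) (λ i → conj (A i j) * y i)) ⟨
    ⟪ x , A ᴴ *ᵥ y ⟫ ∎

  _≟_ : Decidable _≈_
  z ≟ w = (re z ℝ.≟ re w) ×-dec (im z ℝ.≟ im w)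

  0≉1 : ¬ (0# ≈ 1#)
  0≉1 (0≈1 , _) = ℝ.0≉1 0≈1

  inverse : ∀ z → ¬ (z ≈ 0#) → ∃ λ w → z * w ≈ 1#
  inverse z z≉0 = conj z * fromℝ r , (ℝ.trans re-eq zz*r≈1 , im-eq)
    where
    inv = ℝ.inverse (rdot z z) (z≉0 ∘ rdot-definite z ∘ ℝ.≤-reflexive)
    r = proj₁ inv
    zz*r≈1 = proj₂ inv
    re-eq = solve 3 (λ a b r → a :* (a :* r :- :- b :* :0) :- b :* (a :* :0 :+ :- b :* r)
                       := (a :* a :+ b :* b) :* r) ℝ.refl (re z) (im z) r
    im-eq = solve 3 (λ a b r → a :* (a :* :0 :+ :- b :* r) :+ b :* (a :* r :- :- b :* :0)
                       := :0) ℝ.refl (re z) (im z) r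

  singular⊎leftInvertible : (A : Matrix n) →
    (∃ λ v → ¬ (v ≈ᵛ 0ᵛ) × A *ᵥ v ≈ᵛ 0ᵛ) ⊎ (∃ λ (L : Matrix n) → ∀ x → L *ᵥ A *ᵥ x ≈ᵛ x)
  singular⊎leftInvertible = kernel⊎leftInverse _≟_ 0≉1 inverse

  -- The parallelogram law with the term for `z - w` dropped. It stands in for Cauchy-Schwarz, since
  -- only the existence of a bound matters below.
  rdot-+ : ∀ z w → rdot (z + w) (z + w) ℝ.≤
           (rdot z z ℝ.+ rdot z z) ℝ.+ (rdot w w ℝ.+ rdot w w)
  rdot-+ z w = ℝ.≤-by-difference (rdot-nonNegative (z + - w))
    (solve 4 (λ a b c d →
       (a :* a :+ b :* b) :+ (a :* a :+ b :* b) :+ ((c :* c :+ d :* d) :+ (c :* c :+ d :* d))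
       := ((a :+ c) :* (a :+ c) :+ (b :+ d) :* (b :+ d))
          :+ ((a :- c) :* (a :- c) :+ (b :- d) :* (b :- d))) ℝ.refl
       (re z) (im z) (re w) (im w))

  rdot-* : ∀ z w → rdot (z * w) (z * w) ℝ.≈ rdot z z ℝ.* rdot w w
  rdot-* z w = solve 4 (λ a b c d →
    (a :* c :- b :* d) :* (a :* c :- b :* d) :+ (a :* d :+ b :* c) :* (a :* d :+ b :* c)
    := (a :* a :+ b :* b) :* (c :* c :+ d :* d)) ℝ.refl (re z) (im z) (re w) (im w)

  Bounds : ℝ → (Vector ℂ n → ℝ) → Set _
  Bounds C f = ℝ.0# ℝ.≤ C × ∀ x → f x ℝ.≤ C ℝ.* ∥ x ∥²

  row-bounded : ∀ (a : Vector ℂ n) → ∃ λ C → Bounds C λ x →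
                rdot (sum λ j → a j * x j) (sum λ j → a j * x j)
  row-bounded {zero}  a = ℝ.0# , ℝ.≤-refl , λ x →
    ℝ.≤-reflexive (solve 0 (:0 :* :0 :+ :0 :* :0 := :0 :* :0) ℝ.refl)
  row-bounded {suc n} a = extend (row-bounded (tail a))
    where
    α = rdot (a zero) (a zero)

    extend : _ → _
    -- The head and tail estimates give `2 α X + 2 C Y`; adding the mixed terms `2 α Y + 2 C X`
    -- completes the product with `X + Y`.
    extend (C , 0≤C , bound) = (α ℝ.+ α) ℝ.+ (C ℝ.+ C) ,
      ℝ.+-nonNegative (ℝ.+-nonNegative 0≤α 0≤α) (ℝ.+-nonNegative 0≤C 0≤C) , λ x →
      let x₀ = x zero
          X = rdot x₀ x₀
          Y = ∥ tail x ∥²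
          s = sum λ j → a (suc j) * x (suc j)
          0≤αY+CX = ℝ.+-nonNegative (ℝ.*-nonNegative 0≤α (∥∥²-nonNegative (tail x)))
                                    (ℝ.*-nonNegative 0≤C (rdot-nonNegative x₀))
          head≤ = ℝ.≤-reflexive (rdot-* (a zero) x₀)
          tail≤ = bound (tail x)
      in ℝ.≤-trans (rdot-+ (a zero * x₀) s)
        (ℝ.≤-trans (ℝ.+-mono-≤ (ℝ.+-mono-≤ head≤ head≤) (ℝ.+-mono-≤ tail≤ tail≤))
          (ℝ.≤-by-difference (ℝ.+-nonNegative 0≤αY+CX 0≤αY+CX)
            (solve 4 (λ α C X Y → (α :+ α :+ (C :+ C)) :* (X :+ Y) :=
               α :* X :+ α :* X :+ (C :* Y :+ C :* Y)
               :+ (α :* Y :+ C :* X :+ (α :* Y :+ C :* X))) ℝ.refl α C X Y)))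
      where 0≤α = rdot-nonNegative (a zero)

  mat-bounded : ∀ (A : Mat m n) → ∃ λ C → Bounds C λ x → ∥ A ∙ x ∥²
  mat-bounded {zero}  A = ℝ.0# , ℝ.≤-refl , λ x → ℝ.≤-reflexive (ℝ.sym (ℝ.zeroˡ ∥ x ∥²))
  mat-bounded {suc m} A = extend (row-bounded (A zero)) (mat-bounded (tail A))
    where
    extend : _ → _ → _
    extend (C , 0≤C , C-bound) (C′ , 0≤C′ , C′-bound) = C ℝ.+ C′ , ℝ.+-nonNegative 0≤C 0≤C′ , λ x →
      ℝ.≤-trans (ℝ.+-mono-≤ (C-bound x) (C′-bound x)) (ℝ.≤-reflexive
        (solve 3 (λ C C′ X → C :* X :+ C′ :* X := (C :+ C′) :* X) ℝ.refl C C′ ∥ x ∥²))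

-- Existence of the spectral norm.

module SpectralNorm {c ℓ₁ ℓ₂} (R : RealNumbers c ℓ₁ ℓ₂) where
  open ComplexMatrices R
  open ComplexInnerProduct R
  open ℝ using (_²; solve; _:=_; _:+_; _:*_; _:-_; :-_; :0; :1)
  open import Relation.Binary.Reasoning.Setoid ℝ.setoid

  private
    variable
      n : ℕ

  *ᵐ-*ᵥ : ∀ (A B : Matrix n) x → (A *ᵐ B) *ᵥ x ≈ᵛ A *ᵥ B *ᵥ x
  *ᵐ-*ᵥ = ∙-assoc

  diagonal-*ᵥ : ∀ (d x : Vector ℂ n) i → (diagonal d *ᵥ x) i ≈ d i * x i
  diagonal-*ᵥ = sum-δ

  I-*ᵥ : ∀ (x : Vector ℂ n) → I *ᵥ x ≈ᵛ x
  I-*ᵥ x i = ℂRing.trans (diagonal-*ᵥ (λ _ → 1#) x i) (ℂRing.*-identityˡ (x i))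

  -ᵐ-*ᵥ : ∀ (A B : Matrix n) x → (A -ᵐ B) *ᵥ x ≈ᵛ A *ᵥ x ⊝ B *ᵥ x
  -ᵐ-*ᵥ {n} A B x i = ℂRing.trans
    (sum-cong-≋ {n} λ j → ℂRing.*-congʳ (ℂRing.+-congˡ (neg (B i j))))
    (axpy-∙ A B (λ _ → fromℝ (ℝ.- ℝ.1#)) x i)
    where
    open import Algebra.Properties.Semiring.Sum ℂRing.semiring using (sum-cong-≋)
    neg : ∀ z → - z ≈ fromℝ (ℝ.- ℝ.1#) * z
    neg z = solve 2 (λ a b → :- a := :- :1 :* a :- :0 :* b) ℝ.refl (re z) (im z)
          , solve 2 (λ a b → :- b := :- :1 :* b :+ :0 :* a) ℝ.refl (re z) (im z)

  ⟪⟫-·ˡ : ∀ t (x y : Vector ℂ n) → ⟪ fromℝ t ·ᵥ x , y ⟫ ℝ.≈ t ℝ.* ⟪ x , y ⟫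
  ⟪⟫-·ˡ {n} t x y = begin
    ℝΣ.sum (λ i → rdot (fromℝ t * x i) (y i))
      ≈⟨ ℝΣ.sum-cong-≋ {n} (λ i → solve 5 (λ t a b c d →
           (t :* a :- :0 :* b) :* c :+ (t :* b :+ :0 :* a) :* d := t :* (a :* c :+ b :* d))
           ℝ.refl t (re (x i)) (im (x i)) (re (y i)) (im (y i))) ⟩
    ℝΣ.sum (λ i → t ℝ.* rdot (x i) (y i))
      ≈⟨ ℝΣ.*-distribˡ-sum {n} t (λ i → rdot (x i) (y i)) ⟨
    t ℝ.* ⟪ x , y ⟫ ∎

  ⟪⟫-Gram : ∀ (A : Matrix n) x y → ⟪ (A ᴴ *ᵐ A) *ᵥ x , y ⟫ ℝ.≈ ⟪ A *ᵥ x , A *ᵥ y ⟫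
  ⟪⟫-Gram A x y = begin
    ⟪ (A ᴴ *ᵐ A) *ᵥ x , y ⟫     ≈⟨ ⟪⟫-cong (*ᵐ-*ᵥ (A ᴴ) A x) ≈ᵛ-refl ⟩
    ⟪ A ᴴ *ᵥ A *ᵥ x , y ⟫       ≈⟨ ⟪⟫-comm (A ᴴ *ᵥ A *ᵥ x) y ⟩
    ⟪ y , A ᴴ *ᵥ A *ᵥ x ⟫       ≈⟨ ⟪⟫-adjoint A y (A *ᵥ x) ⟨
    ⟪ A *ᵥ y , A *ᵥ x ⟫         ≈⟨ ⟪⟫-comm (A *ᵥ y) (A *ᵥ x) ⟩
    ⟪ A *ᵥ x , A *ᵥ y ⟫         ∎

  -- Links the algebraic definition of singular values to the growth of `∥ A *ᵥ x ∥²`, both for the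
  -- maximality of the norm and for its comparison with 1.
  Gram-eigenvalue : ∀ (A : Matrix n) {μ v} → (A ᴴ *ᵐ A) *ᵥ v ≈ᵛ fromℝ μ ·ᵥ v →
                    ∥ A *ᵥ v ∥² ℝ.≈ μ ℝ.* ∥ v ∥²
  Gram-eigenvalue A {μ} {v} eigen = begin
    ∥ A *ᵥ v ∥²                 ≈⟨ ⟪⟫-Gram A v v ⟨
    ⟪ (A ᴴ *ᵐ A) *ᵥ v , v ⟫     ≈⟨ ⟪⟫-cong eigen ≈ᵛ-refl ⟩
    ⟪ fromℝ μ ·ᵥ v , v ⟫        ≈⟨ ⟪⟫-·ˡ μ v v ⟩
    μ ℝ.* ∥ v ∥²                ∎

  shiftedGram : Matrix n → ℝ → Matrix n
  shiftedGram A s = diagonal (λ _ → fromℝ s) -ᵐ A ᴴ *ᵐ A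

  shiftedGram-*ᵥ : ∀ (A : Matrix n) s x →
                   shiftedGram A s *ᵥ x ≈ᵛ fromℝ s ·ᵥ x ⊝ (A ᴴ *ᵐ A) *ᵥ x
  shiftedGram-*ᵥ A s x i = ℂRing.trans
    (-ᵐ-*ᵥ (diagonal λ _ → fromℝ s) (A ᴴ *ᵐ A) x i)
    (ℂRing.+-congʳ (diagonal-*ᵥ (λ _ → fromℝ s) x i))

  ⟪⟫-shiftedGram : ∀ (A : Matrix n) s x y → ⟪ shiftedGram A s *ᵥ x , y ⟫ ℝ.≈
                   s ℝ.* ⟪ x , y ⟫ ℝ.+ ℝ.- ⟪ A *ᵥ x , A *ᵥ y ⟫
  ⟪⟫-shiftedGram A s x y = begin
    ⟪ shiftedGram A s *ᵥ x , y ⟫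
      ≈⟨ ⟪⟫-cong (shiftedGram-*ᵥ A s x) ≈ᵛ-refl ⟩
    ⟪ fromℝ s ·ᵥ x ⊝ (A ᴴ *ᵐ A) *ᵥ x , y ⟫
      ≈⟨ ⟪⟫-axpyˡ (fromℝ s ·ᵥ x) (ℝ.- ℝ.1#) ((A ᴴ *ᵐ A) *ᵥ x) y ⟩
    ⟪ fromℝ s ·ᵥ x , y ⟫ ℝ.+ ℝ.- ℝ.1# ℝ.* ⟪ (A ᴴ *ᵐ A) *ᵥ x , y ⟫
      ≈⟨ ℝ.+-cong (⟪⟫-·ˡ s x y) (ℝ.*-congˡ (⟪⟫-Gram A x y)) ⟩
    s ℝ.* ⟪ x , y ⟫ ℝ.+ ℝ.- ℝ.1# ℝ.* ⟪ A *ᵥ x , A *ᵥ y ⟫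
      ≈⟨ solve 2 (λ a b → a :+ :- :1 :* b := a :- b) ℝ.refl (s ℝ.* ⟪ x , y ⟫) ⟪ A *ᵥ x , A *ᵥ y ⟫ ⟩
    s ℝ.* ⟪ x , y ⟫ ℝ.+ ℝ.- ⟪ A *ᵥ x , A *ᵥ y ⟫ ∎

  -- Expand `0 ≤ ∥ x ⊝ y ∥²`.
  ⟪⟫-upper : ∀ (x y : Vector ℂ n) → ⟪ x , y ⟫ ℝ.+ ⟪ x , y ⟫ ℝ.≤ ∥ x ∥² ℝ.+ ∥ y ∥²
  ⟪⟫-upper x y = ℝ.≤-by-difference (∥∥²-nonNegative (x ⊝ y)) (begin
    ∥ x ∥² ℝ.+ ∥ y ∥²
      ≈⟨ solve 3 (λ a b c → a :+ c := b :+ b :+ (a :+ (:- :1 :* b :+ :- :1 :* b) :+ :- :1 :* :- :1 :* c))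
           ℝ.refl ∥ x ∥² ⟪ x , y ⟫ ∥ y ∥² ⟩
    ⟪ x , y ⟫ ℝ.+ ⟪ x , y ⟫ ℝ.+ (∥ x ∥² ℝ.+ (ℝ.- ℝ.1# ℝ.* ⟪ x , y ⟫ ℝ.+ ℝ.- ℝ.1# ℝ.* ⟪ x , y ⟫)
      ℝ.+ (ℝ.- ℝ.1#) ² ℝ.* ∥ y ∥²)
      ≈⟨ ℝ.+-congˡ (∥axpy∥² x (ℝ.- ℝ.1#) y) ⟨
    ⟪ x , y ⟫ ℝ.+ ⟪ x , y ⟫ ℝ.+ ∥ x ⊝ y ∥² ∎)

  -- If s - Aᴴ A ≥ 0 has a left inverse L, put y = Lᴴ x, so that
  -- ⟨(s - Aᴴ A) z, y⟩ = ⟨z, x⟩ for every z.  Positivity at x - t y reads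
  -- 0 ≤ q(x) - 2 t ∥x∥² + t² ⟨y, x⟩, and t = 1 / K with ⟨y, x⟩ ≤ K ∥x∥²
  -- leaves q(x) ≥ t ∥x∥².

  coercive : ∀ (A : Matrix n) {s} → (∀ x → ∥ A *ᵥ x ∥² ℝ.≤ s ℝ.* ∥ x ∥²) →
             (∃ λ (L : Matrix n) → ∀ x → L *ᵥ shiftedGram A s *ᵥ x ≈ᵛ x) →
             ∃ λ t → (ℝ.0# ℝ.< t) × (∀ x → ∥ A *ᵥ x ∥² ℝ.≤ (s ℝ.+ ℝ.- t) ℝ.* ∥ x ∥²)
  coercive {n} A {s} bound (L , LM≈1) = go (mat-bounded (L ᴴ))
    where
    -- `L` is known to cancel `shiftedGram A s` from the left only. Moving it to the other argument
    -- as `L ᴴ` uses precisely this order of the factors.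
    dual : ∀ z x → s ℝ.* ⟪ z , L ᴴ *ᵥ x ⟫ ℝ.+ ℝ.- ⟪ A *ᵥ z , A *ᵥ L ᴴ *ᵥ x ⟫ ℝ.≈ ⟪ z , x ⟫
    dual z x = begin
      s ℝ.* ⟪ z , L ᴴ *ᵥ x ⟫ ℝ.+ ℝ.- ⟪ A *ᵥ z , A *ᵥ L ᴴ *ᵥ x ⟫
        ≈⟨ ⟪⟫-shiftedGram A s z (L ᴴ *ᵥ x) ⟨
      ⟪ shiftedGram A s *ᵥ z , L ᴴ *ᵥ x ⟫
        ≈⟨ ⟪⟫-adjoint L (shiftedGram A s *ᵥ z) x ⟨
      ⟪ L *ᵥ shiftedGram A s *ᵥ z , x ⟫
        ≈⟨ ⟪⟫-cong (LM≈1 z) ≈ᵛ-refl ⟩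
      ⟪ z , x ⟫ ∎

    module _ (x : Vector ℂ n) where
      y = L ᴴ *ᵥ x
      q = s ℝ.* ∥ x ∥² ℝ.+ ℝ.- ∥ A *ᵥ x ∥²

      -- By `dual y x`, `⟪ y , x ⟫` is the form at `y`, hence nonnegative and at most its own
      -- double, which is at most `∥ y ∥² + ∥ x ∥²`. This is the origin of `K = C + 1`.
      ⟪y,x⟫-upper : ∀ {C} → ∥ y ∥² ℝ.≤ C ℝ.* ∥ x ∥² → ⟪ y , x ⟫ ℝ.≤ (C ℝ.+ ℝ.1#) ℝ.* ∥ x ∥²
      ⟪y,x⟫-upper {C} ∥y∥²≤ = ℝ.≤-trans
        (ℝ.≤-by-difference (ℝ.≤-respʳ-≈ (dual y x) (ℝ.x≤y⇒0≤y-x (bound y))) ℝ.refl)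
        (ℝ.≤-trans (⟪⟫-upper y x)
          (ℝ.≤-by-difference (ℝ.x≤y⇒0≤y-x ∥y∥²≤)
            (solve 3 (λ C X Y → (C :+ :1) :* X := Y :+ X :+ (C :* X :- Y)) ℝ.refl C ∥ x ∥² ∥ y ∥²)))

      expand : ∀ t → let z = axpy x (fromℝ (ℝ.- t)) y in
               s ℝ.* ∥ z ∥² ℝ.+ ℝ.- ∥ A *ᵥ z ∥² ℝ.≈
               q ℝ.+ ℝ.- (t ℝ.* ∥ x ∥² ℝ.+ t ℝ.* ∥ x ∥²) ℝ.+ t ² ℝ.* ⟪ y , x ⟫
      expand t = begin
        s ℝ.* ∥ z ∥² ℝ.+ ℝ.- ∥ A *ᵥ z ∥²
          ≈⟨ ℝ.+-cong (ℝ.*-congˡ (∥axpy∥² x (ℝ.- t) y)) (ℝ.-‿cong (ℝ.trans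
               (⟪⟫-cong Az≈ Az≈) (∥axpy∥² (A *ᵥ x) (ℝ.- t) (A *ᵥ y)))) ⟩
        s ℝ.* (∥ x ∥² ℝ.+ (ℝ.- t ℝ.* ⟪ x , y ⟫ ℝ.+ ℝ.- t ℝ.* ⟪ x , y ⟫) ℝ.+ (ℝ.- t) ² ℝ.* ∥ y ∥²)
        ℝ.+ ℝ.- (∥ A *ᵥ x ∥² ℝ.+ (ℝ.- t ℝ.* ⟪ A *ᵥ x , A *ᵥ y ⟫ ℝ.+ ℝ.- t ℝ.* ⟪ A *ᵥ x , A *ᵥ y ⟫)
                 ℝ.+ (ℝ.- t) ² ℝ.* ∥ A *ᵥ y ∥²)
          ≈⟨ solve 8 (λ s t a b c d e f →
               s :* (a :+ (:- t :* b :+ :- t :* b) :+ :- t :* :- t :* c)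
               :- (d :+ (:- t :* e :+ :- t :* e) :+ :- t :* :- t :* f)
               := s :* a :- d :- (t :* (s :* b :- e) :+ t :* (s :* b :- e))
                  :+ t :* t :* (s :* c :- f)) ℝ.refl
               s t ∥ x ∥² ⟪ x , y ⟫ ∥ y ∥² ∥ A *ᵥ x ∥² ⟪ A *ᵥ x , A *ᵥ y ⟫ ∥ A *ᵥ y ∥² ⟩
        q ℝ.+ ℝ.- (t ℝ.* (s ℝ.* ⟪ x , y ⟫ ℝ.+ ℝ.- ⟪ A *ᵥ x , A *ᵥ y ⟫)
                   ℝ.+ t ℝ.* (s ℝ.* ⟪ x , y ⟫ ℝ.+ ℝ.- ⟪ A *ᵥ x , A *ᵥ y ⟫))
          ℝ.+ t ² ℝ.* (s ℝ.* ∥ y ∥² ℝ.+ ℝ.- ∥ A *ᵥ y ∥²)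
          ≈⟨ ℝ.+-cong (ℝ.+-congˡ (ℝ.-‿cong (ℝ.+-cong (ℝ.*-congˡ (dual x x)) (ℝ.*-congˡ (dual x x)))))
                      (ℝ.*-congˡ (dual y x)) ⟩
        q ℝ.+ ℝ.- (t ℝ.* ∥ x ∥² ℝ.+ t ℝ.* ∥ x ∥²) ℝ.+ t ² ℝ.* ⟪ y , x ⟫ ∎
        where
        z = axpy x (fromℝ (ℝ.- t)) y
        Az≈ : A *ᵥ z ≈ᵛ axpy (A *ᵥ x) (fromℝ (ℝ.- t)) (A *ᵥ y)
        Az≈ = ∙-axpyʳ A x (fromℝ (ℝ.- t)) y

      strengthened : ∀ {K t} → ⟪ y , x ⟫ ℝ.≤ K ℝ.* ∥ x ∥² → K ℝ.* t ℝ.≈ ℝ.1# →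
                     ∥ A *ᵥ x ∥² ℝ.≤ (s ℝ.+ ℝ.- t) ℝ.* ∥ x ∥²
      strengthened {K} {t} ⟪y,x⟫≤ Kt≈1 = ℝ.≤-by-difference
        (ℝ.+-nonNegative (ℝ.≤-respʳ-≈ (expand t) (ℝ.x≤y⇒0≤y-x (bound (axpy x (fromℝ (ℝ.- t)) y))))
                         (ℝ.*-nonNegative (ℝ.²-nonNegative t) (ℝ.x≤y⇒0≤y-x ⟪y,x⟫≤)))
        (begin
          -- Of the two copies of `t X` subtracted in `expand`, one is restored as `K t (t X)`,
          -- which dominates `t² ⟪ y , x ⟫`.
          (s ℝ.+ ℝ.- t) ℝ.* X
            ≈⟨ solve 4 (λ s t a X → (s :- t) :* X := a :+ (s :* X :- a :- (t :* X :+ t :* X) :+ :1 :* (t :* X)))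
                 ℝ.refl s t a X ⟩
          a ℝ.+ (q ℝ.+ ℝ.- (t ℝ.* X ℝ.+ t ℝ.* X) ℝ.+ ℝ.1# ℝ.* (t ℝ.* X))
            ≈⟨ ℝ.+-congˡ (ℝ.+-congˡ (ℝ.*-congʳ Kt≈1)) ⟨
          a ℝ.+ (q ℝ.+ ℝ.- (t ℝ.* X ℝ.+ t ℝ.* X) ℝ.+ K ℝ.* t ℝ.* (t ℝ.* X))
            ≈⟨ solve 6 (λ a q t X K p → a :+ (q :- (t :* X :+ t :* X) :+ K :* t :* (t :* X))
                 := a :+ (q :- (t :* X :+ t :* X) :+ t :* t :* p :+ t :* t :* (K :* X :- p)))
                 ℝ.refl a q t X K ⟪ y , x ⟫ ⟩
          a ℝ.+ (q ℝ.+ ℝ.- (t ℝ.* X ℝ.+ t ℝ.* X) ℝ.+ t ² ℝ.* ⟪ y , x ⟫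
                 ℝ.+ t ² ℝ.* (K ℝ.* X ℝ.+ ℝ.- ⟪ y , x ⟫)) ∎)
        where
        a = ∥ A *ᵥ x ∥²
        X = ∥ x ∥²

    go : (∃ λ C → Bounds C λ x → ∥ L ᴴ *ᵥ x ∥²) → _
    go (C , 0≤C , ∥Lᴴx∥²≤) = invert (ℝ.inverse-pos 0<K)
      where
      0<K : ℝ.0# ℝ.< C ℝ.+ ℝ.1#
      0<K = ℝ.0<1+nonNeg 0≤C (ℝ.+-comm C ℝ.1#)

      invert : (∃ λ t → (ℝ.0# ℝ.< t) × ((C ℝ.+ ℝ.1#) ℝ.* t ℝ.≈ ℝ.1#)) → _
      invert (t , 0<t , Kt≈1) = t , 0<t , λ x → strengthened x (⟪y,x⟫-upper x (∥Lᴴx∥²≤ x)) Kt≈1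

  -- The downward closure of the set of quotients: it has the same supremum and avoids division.
  RayleighQuotient : Matrix n → ℝ → Set _
  RayleighQuotient A r = ∃ λ x → (ℝ.0# ℝ.< ∥ x ∥²) × (r ℝ.* ∥ x ∥² ℝ.≤ ∥ A *ᵥ x ∥²)

  -- The place where the dimension must be positive: in dimension 0 no vector is nonzero, so there
  -- are no singular values and no norm.
  nonzeroVector : .{{_ : NonZero n}} → ∃ λ (x : Vector ℂ n) → ¬ (x ≈ᵛ 0ᵛ)
  nonzeroVector {suc n} = (λ _ → 1#) , λ 1≈0 → 0≉1 (ℂRing.sym (1≈0 zero))

  0-Rayleigh : .{{_ : NonZero n}} (A : Matrix n) → RayleighQuotient A ℝ.0#
  0-Rayleigh A = let x , x≉0 = nonzeroVector in
    x , ∥∥²-positive x≉0 , ℝ.≤-respˡ-≈ (ℝ.sym (ℝ.zeroˡ _)) (∥∥²-nonNegative (A *ᵥ x))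

  module RayleighSupremum (A : Matrix n) {s} (isSup : ℝ.IsSupremum (RayleighQuotient A) s) where

    Gram≤s : ∀ x → ∥ A *ᵥ x ∥² ℝ.≤ s ℝ.* ∥ x ∥²
    Gram≤s x = go (ℝ.0# ℝ.≟ ∥ x ∥²)
      where
      go : Dec (ℝ.0# ℝ.≈ ∥ x ∥²) → ∥ A *ᵥ x ∥² ℝ.≤ s ℝ.* ∥ x ∥²
      -- The zero vector has no quotient, so the supremum says nothing about it; both sides vanish.
      go (yes 0≈∥x∥²) = ℝ.≤-reflexive (begin
        ∥ A *ᵥ x ∥²      ≈⟨ ⟪⟫-cong Ax≈0 Ax≈0 ⟩
        ∥ 0ᵛ {n} ∥²      ≈⟨ ⟪⟫-cong x≈0 x≈0 ⟨
        ∥ x ∥²           ≈⟨ 0≈∥x∥² ⟨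
        ℝ.0#             ≈⟨ ℝ.zeroʳ s ⟨
        s ℝ.* ℝ.0#       ≈⟨ ℝ.*-congˡ 0≈∥x∥² ⟩
        s ℝ.* ∥ x ∥²     ∎)
        where
        x≈0 = ∥∥²-definite {x = x} (ℝ.≤-reflexive (ℝ.sym 0≈∥x∥²))
        Ax≈0 : A *ᵥ x ≈ᵛ 0ᵛ
        Ax≈0 = ∙-zeroʳ A x≈0
      go (no 0≉∥x∥²) = divide (ℝ.inverse-pos 0<∥x∥²)
        where
        0<∥x∥² : ℝ.0# ℝ.< ∥ x ∥²
        0<∥x∥² = ∥∥²-nonNegative x , 0≉∥x∥²

        divide : (∃ λ b → (ℝ.0# ℝ.< b) × (∥ x ∥² ℝ.* b ℝ.≈ ℝ.1#)) → _
        divide (b , _ , ∥x∥²b≈1) = ℝ.≤-respˡ-≈ r∥x∥²≈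
          (ℝ.≤-respˡ-≈ (ℝ.*-comm ∥ x ∥² r) (ℝ.≤-respʳ-≈ (ℝ.*-comm ∥ x ∥² s)
            (ℝ.*-monoˡ-≤-nonNeg (proj₁ 0<∥x∥²)
              (proj₁ isSup r (x , 0<∥x∥² , ℝ.≤-reflexive r∥x∥²≈)))))
          where
          r = ∥ A *ᵥ x ∥² ℝ.* b
          r∥x∥²≈ : r ℝ.* ∥ x ∥² ℝ.≈ ∥ A *ᵥ x ∥²
          r∥x∥²≈ = begin
            ∥ A *ᵥ x ∥² ℝ.* b ℝ.* ∥ x ∥²
              ≈⟨ solve 3 (λ a b X → a :* b :* X := a :* (X :* b)) ℝ.refl ∥ A *ᵥ x ∥² b ∥ x ∥² ⟩
            ∥ A *ᵥ x ∥² ℝ.* (∥ x ∥² ℝ.* b)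
              ≈⟨ ℝ.*-congˡ ∥x∥²b≈1 ⟩
            ∥ A *ᵥ x ∥² ℝ.* ℝ.1#
              ≈⟨ ℝ.*-identityʳ _ ⟩
            ∥ A *ᵥ x ∥² ∎

    eigenvector : ∃ λ v → ¬ (v ≈ᵛ 0ᵛ) × (A ᴴ *ᵐ A) *ᵥ v ≈ᵛ fromℝ s ·ᵥ v
    eigenvector = go (singular⊎leftInvertible (shiftedGram A s))
      where
      go : _ ⊎ _ → _
      go (inj₁ (v , v≉0 , Mv≈0)) = v , v≉0 , ≈ᵛ-sym (x⊝y≈0⇒x≈y
        (≈ᵛ-trans (≈ᵛ-sym (shiftedGram-*ᵥ A s v)) Mv≈0))
      go (inj₂ leftInverse) = absurd (coercive A Gram≤s leftInverse)
        where
        absurd : (∃ λ t → (ℝ.0# ℝ.< t) × (∀ x → ∥ A *ᵥ x ∥² ℝ.≤ (s ℝ.+ ℝ.- t) ℝ.* ∥ x ∥²)) → _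
        absurd (t , 0<t , bound) = contradiction t≤0 (ℝ.<⇒≱ 0<t)
          where
          s≤s-t : s ℝ.≤ s ℝ.+ ℝ.- t
          s≤s-t = proj₂ isSup (s ℝ.+ ℝ.- t) λ r (x , 0<∥x∥² , r∥x∥²≤) →
            ℝ.*-cancelʳ-≤-pos 0<∥x∥² (ℝ.≤-trans r∥x∥²≤ (bound x))
          t≤0 : t ℝ.≤ ℝ.0#
          t≤0 = ℝ.≤-by-difference (ℝ.x≤y⇒0≤y-x s≤s-t)
            (solve 2 (λ s t → :0 := t :+ (s :- t :- s)) ℝ.refl s t)

  spectralNorm : .{{_ : NonZero n}} (A : Matrix n) → ∃ (IsSpectralNorm A)
  spectralNorm {n} A = go (ℝ.supremum (RayleighQuotient A) (ℝ.0# , 0-Rayleigh A) (bounded (mat-bounded A)))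
    where
    bounded : (∃ λ C → Bounds C λ x → ∥ A *ᵥ x ∥²) → ∃ (ℝ.IsUpperBound (RayleighQuotient A))
    bounded (C , _ , bound) = C , λ r (x , 0<∥x∥² , r∥x∥²≤) →
      ℝ.*-cancelʳ-≤-pos 0<∥x∥² (ℝ.≤-trans r∥x∥²≤ (bound x))

    go : ∃ (ℝ.IsSupremum (RayleighQuotient A)) → ∃ (IsSpectralNorm A)
    go (s , isSup) = root (ℝ.sqrt (proj₁ isSup ℝ.0# (0-Rayleigh A)))
      where
      open RayleighSupremum A isSup
      root : (∃ λ σ → (ℝ.0# ℝ.≤ σ) × (σ ² ℝ.≈ s)) → ∃ (IsSpectralNorm A)
      root (σ , 0≤σ , σ²≈s) = σ , (0≤σ , v , v≉0 , eigen) , maximal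
        where
        v = proj₁ eigenvector
        v≉0 = proj₁ (proj₂ eigenvector)
        eigen : (A ᴴ *ᵐ A) *ᵥ v ≈ᵛ fromℝ (σ ²) ·ᵥ v
        eigen i = ℂRing.trans (proj₂ (proj₂ eigenvector) i)
                              (ℂRing.*-congʳ {x = v i} (ℝ.sym σ²≈s , ℝ.refl))
        maximal : ∀ τ → IsSingularValue A τ → τ ℝ.≤ σ
        -- `τ²` is the quotient `∥ A w ∥² / ∥ w ∥²`, hence at most `s = σ²`.
        maximal τ (0≤τ , w , w≉0 , AᴴAw≈τ²w) = ℝ.²-cancel-≤ 0≤σ
          (ℝ.≤-respʳ-≈ (ℝ.sym σ²≈s) (ℝ.*-cancelʳ-≤-pos (∥∥²-positive w≉0)
            (ℝ.≤-respˡ-≈ (Gram-eigenvalue A AᴴAw≈τ²w) (Gram≤s w))))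

-- Orthogonal projections and their conjugates.

module Projections {c ℓ₁ ℓ₂} (R : RealNumbers c ℓ₁ ℓ₂) where
  open ComplexMatrices R
  open ComplexInnerProduct R
  open SpectralNorm R
  open ℝ using (_²; solve; _:=_; _:+_; _:*_; _:-_; :-_; :0; :1)
  open import Relation.Binary.Reasoning.Setoid ℝ.setoid

  private
    variable
      n : ℕ

  -- Stated through the action on vectors, the form in which projections are applied below; matrix
  -- products then compose as maps.
  record IsOrthogonalProjection (P : Matrix n) : Set (c ⊔ ℓ₁) where
    field
      idempotent  : ∀ x → P *ᵥ P *ᵥ x ≈ᵛ P *ᵥ x
      selfAdjoint : ∀ x y → ⟪ P *ᵥ x , y ⟫ ℝ.≈ ⟪ x , P *ᵥ y ⟫

    -- Both properties together give `⟪ x , P x ⟫ = ∥ P x ∥²`, which collapses the expansion of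
    -- `∥ x ⊝ P x ∥²`.
    pythagoras : ∀ x → ∥ x ∥² ℝ.≈ ∥ P *ᵥ x ∥² ℝ.+ ∥ x ⊝ P *ᵥ x ∥²
    pythagoras x = begin
      ∥ x ∥²
        ≈⟨ solve 2 (λ a b → a := b :+ (a :+ (:- :1 :* b :+ :- :1 :* b) :+ :- :1 :* :- :1 :* b))
             ℝ.refl ∥ x ∥² ∥ P *ᵥ x ∥² ⟩
      ∥ P *ᵥ x ∥² ℝ.+ (∥ x ∥² ℝ.+ (ℝ.- ℝ.1# ℝ.* ∥ P *ᵥ x ∥² ℝ.+ ℝ.- ℝ.1# ℝ.* ∥ P *ᵥ x ∥²)
                       ℝ.+ (ℝ.- ℝ.1#) ² ℝ.* ∥ P *ᵥ x ∥²)
        ≈⟨ ℝ.+-congˡ (ℝ.+-congʳ (ℝ.+-congˡ (ℝ.+-cong (ℝ.*-congˡ x∙Px) (ℝ.*-congˡ x∙Px)))) ⟨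
      ∥ P *ᵥ x ∥² ℝ.+ (∥ x ∥² ℝ.+ (ℝ.- ℝ.1# ℝ.* ⟪ x , P *ᵥ x ⟫ ℝ.+ ℝ.- ℝ.1# ℝ.* ⟪ x , P *ᵥ x ⟫)
                       ℝ.+ (ℝ.- ℝ.1#) ² ℝ.* ∥ P *ᵥ x ∥²)
        ≈⟨ ℝ.+-congˡ (∥axpy∥² x (ℝ.- ℝ.1#) (P *ᵥ x)) ⟨
      ∥ P *ᵥ x ∥² ℝ.+ ∥ x ⊝ P *ᵥ x ∥² ∎
      where
      x∙Px : ⟪ x , P *ᵥ x ⟫ ℝ.≈ ∥ P *ᵥ x ∥²
      x∙Px = ℝ.trans (⟪⟫-cong {x = x} ≈ᵛ-refl (≈ᵛ-sym (idempotent x)))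
                     (ℝ.sym (selfAdjoint x (P *ᵥ x)))

  open IsOrthogonalProjection

  *ᵥ-cong : ∀ (A : Matrix n) {x y} → x ≈ᵛ y → A *ᵥ x ≈ᵛ A *ᵥ y
  *ᵥ-cong = ∙-congˡ

  ⊝-cong : ∀ {x x′ y y′ : Vector ℂ n} → x ≈ᵛ x′ → y ≈ᵛ y′ → x ⊝ y ≈ᵛ x′ ⊝ y′
  ⊝-cong x≈x′ y≈y′ i = ℂRing.+-cong (x≈x′ i) (ℂRing.*-congˡ {x = fromℝ (ℝ.- ℝ.1#)} (y≈y′ i))

  x⊝[x⊝y]≈y : ∀ (x y : Vector ℂ n) → x ⊝ (x ⊝ y) ≈ᵛ y
  x⊝[x⊝y]≈y x y i =
    solve 4 (λ a b c d → a :+ (:- :1 :* (a :+ (:- :1 :* c :- :0 :* d))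
                               :- :0 :* (b :+ (:- :1 :* d :+ :0 :* c))) := c) ℝ.refl
      (re (x i)) (im (x i)) (re (y i)) (im (y i)) ,
    solve 4 (λ a b c d → b :+ (:- :1 :* (b :+ (:- :1 :* d :+ :0 :* c))
                               :+ :0 :* (a :+ (:- :1 :* c :- :0 :* d))) := d) ℝ.refl
      (re (x i)) (im (x i)) (re (y i)) (im (y i))

  -- Detaches the entry of `indicator S` from the membership test, so that it can be treated by
  -- cases on a Boolean.
  bit : Bool → ℂ
  bit b = if b then 1# else 0#

  bit-idempotent : ∀ b z → bit b * (bit b * z) ≈ bit b * z
  bit-idempotent true  z = ℂRing.*-identityˡ (1# * z)
  bit-idempotent false z = ℂRing.trans (ℂRing.zeroˡ (0# * z)) (ℂRing.sym (ℂRing.zeroˡ z))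

  bit-selfAdjoint : ∀ b z w → rdot (bit b * z) w ℝ.≈ rdot z (bit b * w)
  bit-selfAdjoint b z w = ℝ.trans (rdot-adjoint (bit b) z w)
    (rdot-cong {z = z} ℂRing.refl (ℂRing.*-congʳ {x = w} (conj-bit b)))
    where
    conj-bit : ∀ b → conj (bit b) ≈ bit b
    conj-bit true  = ℝ.refl , solve 0 (:- :0 := :0) ℝ.refl
    conj-bit false = ℝ.refl , solve 0 (:- :0 := :0) ℝ.refl

  indicator-isProjection : ∀ (S : Subset n) → IsOrthogonalProjection (𝐃 S)
  indicator-isProjection {n} S = record
    { idempotent  = λ x i → ℂRing.trans (act (𝐃 S *ᵥ x) i)
        (ℂRing.trans (ℂRing.*-congˡ {x = indicator S i} (act x i))
          (ℂRing.trans (bit-idempotent (does (i ∈? S)) (x i)) (ℂRing.sym (act x i))))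
    ; selfAdjoint = λ x y → begin
        ⟪ 𝐃 S *ᵥ x , y ⟫
          ≈⟨ ⟪⟫-cong (act x) (≈ᵛ-refl {x = y}) ⟩
        ⟪ (λ i → indicator S i * x i) , y ⟫
          ≈⟨ ℝΣ.sum-cong-≋ {n} (λ i → bit-selfAdjoint (does (i ∈? S)) (x i) (y i)) ⟩
        ⟪ x , (λ i → indicator S i * y i) ⟫
          ≈⟨ ⟪⟫-cong (≈ᵛ-refl {x = x}) (act y) ⟨
        ⟪ x , 𝐃 S *ᵥ y ⟫ ∎
    }
    where
    act : ∀ x i → (𝐃 S *ᵥ x) i ≈ indicator S i * x i
    act = diagonal-*ᵥ (indicator S)

  -- In the square of `U P Uᴴ` the inner `Uᴴ U` cancels; for self-adjointness `half` moves the outer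
  -- `U` to the other argument.
  conjugate-isProjection : ∀ {U P : Matrix n} → (U ᴴ *ᵐ U) ≈ᵐ I →
                           IsOrthogonalProjection P → IsOrthogonalProjection (U *ᵐ P *ᵐ U ᴴ)
  conjugate-isProjection {n} {U} {P} UᴴU≈I isP = record
    { idempotent  = λ x → ≈ᵛ-trans (UPUᴴ ((U *ᵐ P *ᵐ U ᴴ) *ᵥ x))
        (≈ᵛ-trans (*ᵥ-cong U (≈ᵛ-trans
          (*ᵥ-cong P (≈ᵛ-trans (*ᵥ-cong (U ᴴ) (UPUᴴ x)) (Uᴴ∘U (P *ᵥ U ᴴ *ᵥ x))))
          (idempotent isP (U ᴴ *ᵥ x))))
          (≈ᵛ-sym (UPUᴴ x)))
    ; selfAdjoint = λ x y → begin
        ⟪ (U *ᵐ P *ᵐ U ᴴ) *ᵥ x , y ⟫      ≈⟨ half x y ⟩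
        ⟪ P *ᵥ U ᴴ *ᵥ x , U ᴴ *ᵥ y ⟫      ≈⟨ selfAdjoint isP (U ᴴ *ᵥ x) (U ᴴ *ᵥ y) ⟩
        ⟪ U ᴴ *ᵥ x , P *ᵥ U ᴴ *ᵥ y ⟫      ≈⟨ ⟪⟫-comm (U ᴴ *ᵥ x) (P *ᵥ U ᴴ *ᵥ y) ⟩
        ⟪ P *ᵥ U ᴴ *ᵥ y , U ᴴ *ᵥ x ⟫      ≈⟨ half y x ⟨
        ⟪ (U *ᵐ P *ᵐ U ᴴ) *ᵥ y , x ⟫      ≈⟨ ⟪⟫-comm ((U *ᵐ P *ᵐ U ᴴ) *ᵥ y) x ⟩
        ⟪ x , (U *ᵐ P *ᵐ U ᴴ) *ᵥ y ⟫      ∎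
    }
    where
    open import Algebra.Properties.Semiring.Sum ℂRing.semiring using (sum-cong-≋)

    Uᴴ∘U : ∀ x → U ᴴ *ᵥ U *ᵥ x ≈ᵛ x
    Uᴴ∘U x = ≈ᵛ-trans (≈ᵛ-sym (*ᵐ-*ᵥ (U ᴴ) U x))
      (≈ᵛ-trans (λ i → sum-cong-≋ {n} λ j → ℂRing.*-congʳ {x = x j} (UᴴU≈I i j)) (I-*ᵥ x))

    UPUᴴ : ∀ x → (U *ᵐ P *ᵐ U ᴴ) *ᵥ x ≈ᵛ U *ᵥ P *ᵥ U ᴴ *ᵥ x
    UPUᴴ x = ≈ᵛ-trans (*ᵐ-*ᵥ (U *ᵐ P) (U ᴴ) x) (*ᵐ-*ᵥ U P (U ᴴ *ᵥ x))

    half : ∀ x y → ⟪ (U *ᵐ P *ᵐ U ᴴ) *ᵥ x , y ⟫ ℝ.≈ ⟪ P *ᵥ U ᴴ *ᵥ x , U ᴴ *ᵥ y ⟫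
    half x y = ℝ.trans (⟪⟫-cong (UPUᴴ x) (≈ᵛ-refl {x = y})) (⟪⟫-adjoint U (P *ᵥ U ᴴ *ᵥ x) y)

  -- Localized vectors, the norm bound and recovery.

  module Sampling {D B : Matrix n} (isD : IsOrthogonalProjection D) (isB : IsOrthogonalProjection B) where

    D̄ A : Matrix n
    D̄ = I -ᵐ D
    A = B *ᵐ D̄

    -- Each condition of the theorem is compared with the absence of such a vector. `D y = 0` is the
    -- form that Pythagoras produces and that defeats recovery; `D̄ y = y` is its translation.
    Localized : Vector ℂ n → Set _
    Localized y = ¬ (y ≈ᵛ 0ᵛ) × D *ᵥ y ≈ᵛ 0ᵛ × Fixes B y

    D̄-*ᵥ : ∀ x → D̄ *ᵥ x ≈ᵛ x ⊝ D *ᵥ x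
    D̄-*ᵥ x = ≈ᵛ-trans (-ᵐ-*ᵥ I D x) (⊝-cong (I-*ᵥ x) (≈ᵛ-refl {x = D *ᵥ x}))

    x⊝0≈x : ∀ {x y : Vector ℂ n} → y ≈ᵛ 0ᵛ → x ⊝ y ≈ᵛ x
    x⊝0≈x {x} {y} y≈0 = ≈ᵛ-trans (⊝-cong (≈ᵛ-refl {x = x}) y≈x⊝x) (x⊝[x⊝y]≈y x x)
      where
      y≈x⊝x : y ≈ᵛ x ⊝ x
      y≈x⊝x = ≈ᵛ-trans y≈0 (≈ᵛ-sym (x≈y⇒x⊝y≈0 (≈ᵛ-refl {x = x})))

    D̄-fixes : ∀ {x} → D *ᵥ x ≈ᵛ 0ᵛ → Fixes D̄ x
    D̄-fixes {x} Dx≈0 = ≈ᵛ-trans (D̄-*ᵥ x) (x⊝0≈x Dx≈0)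

    D̄-fixes⇒D≈0 : ∀ {x} → Fixes D̄ x → D *ᵥ x ≈ᵛ 0ᵛ
    D̄-fixes⇒D≈0 {x} D̄x≈x = ≈ᵛ-trans (≈ᵛ-sym (x⊝[x⊝y]≈y x (D *ᵥ x)))
      (x≈y⇒x⊝y≈0 (≈ᵛ-trans (≈ᵛ-sym D̄x≈x) (D̄-*ᵥ x)))

    -- ∥x∥² - ∥B D̄ x∥² = ∥D x∥² + ∥D̄ x - B D̄ x∥².

    norm-nondecreasing⇒localized : ∀ {x} → ∥ x ∥² ℝ.≤ ∥ A *ᵥ x ∥² → D *ᵥ x ≈ᵛ 0ᵛ × Fixes B x
    norm-nondecreasing⇒localized {x} ∥x∥²≤∥Ax∥² = Dx≈0 ,
      ≈ᵛ-trans (*ᵥ-cong B (≈ᵛ-sym w≈x)) (≈ᵛ-trans (≈ᵛ-sym (x⊝y≈0⇒x≈y (∥∥²-definite (ℝ.≤-reflexive (proj₂ both))))) w≈x)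
      where
      w = x ⊝ D *ᵥ x
      Ax≈Bw : A *ᵥ x ≈ᵛ B *ᵥ w
      Ax≈Bw = ≈ᵛ-trans (*ᵐ-*ᵥ B D̄ x) (*ᵥ-cong B (D̄-*ᵥ x))
      split : ∥ x ∥² ℝ.≈ ∥ B *ᵥ w ∥² ℝ.+ (∥ D *ᵥ x ∥² ℝ.+ ∥ w ⊝ B *ᵥ w ∥²)
      split = begin
        ∥ x ∥²
          ≈⟨ pythagoras isD x ⟩
        ∥ D *ᵥ x ∥² ℝ.+ ∥ w ∥²
          ≈⟨ ℝ.+-congˡ (pythagoras isB w) ⟩
        ∥ D *ᵥ x ∥² ℝ.+ (∥ B *ᵥ w ∥² ℝ.+ ∥ w ⊝ B *ᵥ w ∥²)
          ≈⟨ solve 3 (λ a b c → a :+ (b :+ c) := b :+ (a :+ c)) ℝ.refl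
               ∥ D *ᵥ x ∥² ∥ B *ᵥ w ∥² ∥ w ⊝ B *ᵥ w ∥² ⟩
        ∥ B *ᵥ w ∥² ℝ.+ (∥ D *ᵥ x ∥² ℝ.+ ∥ w ⊝ B *ᵥ w ∥²) ∎
      excess≤0 : ∥ D *ᵥ x ∥² ℝ.+ ∥ w ⊝ B *ᵥ w ∥² ℝ.≤ ℝ.0#
      excess≤0 = ℝ.≤-by-difference
        (ℝ.x≤y⇒0≤y-x (ℝ.≤-respˡ-≈ split (ℝ.≤-respʳ-≈ (⟪⟫-cong Ax≈Bw Ax≈Bw) ∥x∥²≤∥Ax∥²)))
        (solve 2 (λ a b → :0 := b :+ (a :- (a :+ b))) ℝ.refl
           ∥ B *ᵥ w ∥² (∥ D *ᵥ x ∥² ℝ.+ ∥ w ⊝ B *ᵥ w ∥²))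
      both = ℝ.nonNeg-sum≤0 (∥∥²-nonNegative (D *ᵥ x)) (∥∥²-nonNegative (w ⊝ B *ᵥ w)) excess≤0
      Dx≈0 : D *ᵥ x ≈ᵛ 0ᵛ
      Dx≈0 = ∥∥²-definite (ℝ.≤-reflexive (proj₁ both))
      w≈x : w ≈ᵛ x
      w≈x = x⊝0≈x Dx≈0

    localized⇒A-fixes : ∀ {y} → Localized y → Fixes A y
    localized⇒A-fixes {y} (_ , Dy≈0 , By≈y) =
      ≈ᵛ-trans (*ᵐ-*ᵥ B D̄ y) (≈ᵛ-trans (*ᵥ-cong B (D̄-fixes Dy≈0)) By≈y)

    -- In effect `Aᴴ = D̄ B`. The identity is tested against every `z`, which needs only the
    -- self-adjointness of the two projections and no formula for the entries of `A ᴴ`.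
    localized⇒Aᴴ-fixes : ∀ {y} → Localized y → Fixes (A ᴴ) y
    localized⇒Aᴴ-fixes {y} (_ , Dy≈0 , By≈y) = ⟪⟫-nondegenerate λ z → begin
      ⟪ A ᴴ *ᵥ y , z ⟫
        ≈⟨ ⟪⟫-comm (A ᴴ *ᵥ y) z ⟩
      ⟪ z , A ᴴ *ᵥ y ⟫
        ≈⟨ ⟪⟫-adjoint A z y ⟨
      ⟪ A *ᵥ z , y ⟫
        ≈⟨ ⟪⟫-cong (≈ᵛ-trans (*ᵐ-*ᵥ B D̄ z) (*ᵥ-cong B (D̄-*ᵥ z))) (≈ᵛ-refl {x = y}) ⟩
      ⟪ B *ᵥ (z ⊝ D *ᵥ z) , y ⟫
        ≈⟨ selfAdjoint isB (z ⊝ D *ᵥ z) y ⟩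
      ⟪ z ⊝ D *ᵥ z , B *ᵥ y ⟫
        ≈⟨ ⟪⟫-cong (≈ᵛ-refl {x = z ⊝ D *ᵥ z}) By≈y ⟩
      ⟪ z ⊝ D *ᵥ z , y ⟫
        ≈⟨ ⟪⟫-axpyˡ z (ℝ.- ℝ.1#) (D *ᵥ z) y ⟩
      ⟪ z , y ⟫ ℝ.+ ℝ.- ℝ.1# ℝ.* ⟪ D *ᵥ z , y ⟫
        ≈⟨ ℝ.+-congˡ (ℝ.*-congˡ (ℝ.trans (selfAdjoint isD z y) (⟪⟫-comm z (D *ᵥ y)))) ⟩
      ⟪ z , y ⟫ ℝ.+ ℝ.- ℝ.1# ℝ.* ⟪ D *ᵥ y , z ⟫
        ≈⟨ ℝ.+-congʳ (⟪⟫-comm z y) ⟩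
      ⟪ y , z ⟫ ℝ.+ ℝ.- ℝ.1# ℝ.* ⟪ D *ᵥ y , z ⟫
        ≈⟨ ⟪⟫-axpyˡ y (ℝ.- ℝ.1#) (D *ᵥ y) z ⟨
      ⟪ y ⊝ D *ᵥ y , z ⟫
        ≈⟨ ⟪⟫-cong (x⊝0≈x Dy≈0) (≈ᵛ-refl {x = z}) ⟩
      ⟪ y , z ⟫ ∎

    -- `μ` is equal to `1#` only up to `_≈_`, because the singular value 1 enters as `fromℝ` of the
    -- square of `1ℝ`.
    fixes⇒eigen-1 : ∀ {M : Matrix n} {μ y} → μ ≈ 1# → Fixes M y → M *ᵥ y ≈ᵛ μ ·ᵥ y
    fixes⇒eigen-1 {y = y} μ≈1 My≈y i = ℂRing.trans (My≈y i)
      (ℂRing.trans (ℂRing.sym (ℂRing.*-identityˡ (y i))) (ℂRing.*-congʳ {x = y i} (ℂRing.sym μ≈1)))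

    localized⇒singularValue-1 : ∀ {y} → Localized y → IsSingularValue A 1ℝ
    localized⇒singularValue-1 {y} loc = ℝ.0≤1 , y , proj₁ loc ,
      fixes⇒eigen-1 (ℝ.*-identityˡ ℝ.1# , ℝ.refl)
        (≈ᵛ-trans (*ᵐ-*ᵥ (A ᴴ) A y)
          (≈ᵛ-trans (*ᵥ-cong (A ᴴ) (localized⇒A-fixes loc)) (localized⇒Aᴴ-fixes loc)))

    localized⇒eigenvector : ∀ {y} → Localized y →
                            IsEigenvector (B *ᵐ D̄ *ᵐ B) y × Fixes D̄ y × Fixes B y
    localized⇒eigenvector {y} loc@(y≉0 , Dy≈0 , By≈y) =
      (1# , y≉0 , fixes⇒eigen-1 ℂRing.refl
        (≈ᵛ-trans (*ᵐ-*ᵥ A B y) (≈ᵛ-trans (*ᵥ-cong A By≈y) (localized⇒A-fixes loc)))) ,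
      D̄-fixes Dy≈0 , By≈y

    eigenvector⇒localized : ∀ {y} → IsEigenvector (B *ᵐ D̄ *ᵐ B) y × Fixes D̄ y × Fixes B y →
                            Localized y
    eigenvector⇒localized ((_ , y≉0 , _) , D̄y≈y , By≈y) = y≉0 , D̄-fixes⇒D≈0 D̄y≈y , By≈y

    recoverable⇒¬localized : Recoverable D B → ¬ ∃ Localized
    recoverable⇒¬localized (Q , QD) (y , y≉0 , Dy≈0 , By≈y) =
      y≉0 (≈ᵛ-trans (≈ᵛ-sym (QD y By≈y)) (∙-zeroʳ Q Dy≈0))

    norm<1⇒¬localized : ∥ A ∥₂< 1ℝ → ¬ ∃ Localized
    norm<1⇒¬localized (σ , (_ , maximal) , σ<1) (y , loc) =
      ℝ.<⇒≱ σ<1 (maximal 1ℝ (localized⇒singularValue-1 loc))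

    -- The norm is attained at some `v`. If `1 ≤ σ`, then `∥ A v ∥² = σ² ∥ v ∥² ≥ ∥ v ∥²` by
    -- `σ² - 1 = (σ + 1) (σ - 1)`, so `v` would be localized.
    ¬localized⇒norm<1 : .{{_ : NonZero n}} → ¬ ∃ Localized → ∥ A ∥₂< 1ℝ
    ¬localized⇒norm<1 ¬loc = go (spectralNorm A)
      where
      go : ∃ (IsSpectralNorm A) → ∥ A ∥₂< 1ℝ
      go (σ , isNorm@((0≤σ , v , v≉0 , eigen) , _)) = σ , isNorm , σ≤1 , 1≰σ ∘ ℝ.≤-reflexive ∘ ℝ.sym
        where
        1≰σ : ¬ (1ℝ ℝ.≤ σ)
        1≰σ 1≤σ = ¬loc (v , v≉0 , norm-nondecreasing⇒localized
          (ℝ.≤-respʳ-≈ (ℝ.sym (Gram-eigenvalue A eigen)) (ℝ.≤-by-difference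
            (ℝ.*-nonNegative (ℝ.+-nonNegative (ℝ.*-nonNegative 0≤σ 0≤σ-1) 0≤σ-1) (∥∥²-nonNegative v))
            (solve 2 (λ σ X → σ :* σ :* X := X :+ (σ :* (σ :- :1) :+ (σ :- :1)) :* X)
               ℝ.refl σ ∥ v ∥²))))
          where 0≤σ-1 = ℝ.x≤y⇒0≤y-x 1≤σ
        σ≤1 : σ ℝ.≤ 1ℝ
        σ≤1 = fromInj₁ (λ 1≤σ → contradiction 1≤σ 1≰σ) (ℝ.total σ 1ℝ)

    localized⊎recoverable : ∃ Localized ⊎ Recoverable D B
    localized⊎recoverable = go (singular⊎leftInvertible (I -ᵐ A))
      where
      M-*ᵥ : ∀ x → (I -ᵐ A) *ᵥ x ≈ᵛ x ⊝ A *ᵥ x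
      M-*ᵥ x = ≈ᵛ-trans (-ᵐ-*ᵥ I A x) (⊝-cong (I-*ᵥ x) (≈ᵛ-refl {x = A *ᵥ x}))

      -- With `B x = x`, `x - B (x - D x)` loses both copies of `x`.
      M≈BD : ∀ {x} → Fixes B x → (I -ᵐ A) *ᵥ x ≈ᵛ B *ᵥ D *ᵥ x
      M≈BD {x} Bx≈x = ≈ᵛ-trans (M-*ᵥ x) (≈ᵛ-trans (⊝-cong (≈ᵛ-refl {x = x}) Ax≈)
                                                 (x⊝[x⊝y]≈y x (B *ᵥ D *ᵥ x)))
        where
        Ax≈ : A *ᵥ x ≈ᵛ x ⊝ B *ᵥ D *ᵥ x
        Ax≈ = ≈ᵛ-trans (*ᵐ-*ᵥ B D̄ x) (≈ᵛ-trans (*ᵥ-cong B (D̄-*ᵥ x))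
          (≈ᵛ-trans (∙-axpyʳ B x (fromℝ (ℝ.- ℝ.1#)) (D *ᵥ x))
                    (⊝-cong Bx≈x (≈ᵛ-refl {x = B *ᵥ D *ᵥ x}))))

      go : _ ⊎ _ → ∃ Localized ⊎ Recoverable D B
      go (inj₁ (y , y≉0 , My≈0)) = inj₁ (y , y≉0 , norm-nondecreasing⇒localized
        (ℝ.≤-reflexive (⟪⟫-cong y≈Ay y≈Ay)))
        where
        y≈Ay : y ≈ᵛ A *ᵥ y
        y≈Ay = x⊝y≈0⇒x≈y (≈ᵛ-trans (≈ᵛ-sym (M-*ᵥ y)) My≈0)
      go (inj₂ (L , LM≈1)) = inj₂ (L *ᵐ B , λ x Bx≈x →
        ≈ᵛ-trans (*ᵐ-*ᵥ L B (D *ᵥ x))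
          (≈ᵛ-trans (*ᵥ-cong L (≈ᵛ-sym (M≈BD Bx≈x))) (LM≈1 x)))

    ¬localized⇒recoverable : ¬ ∃ Localized → Recoverable D B
    ¬localized⇒recoverable ¬loc = fromInj₂ (λ loc → contradiction loc ¬loc) localized⊎recoverable

mainTheorem5 :
    ∀ {c ℓ₁ ℓ₂} (R : RealNumbers c ℓ₁ ℓ₂) →
    let open ComplexMatrices R in
    (N : ℕ) .{{_ : NonZero N}} (U : Matrix N) → IsUnitary U →
    (S F : Subset N) →
    let D = 𝐃 S
        D̄ = 𝐃̄ S
        B = 𝐁 U F
    in
    (Recoverable D B ⇔ ∥ B *ᵐ D̄ ∥₂< 1ℝ)
    × (∥ B *ᵐ D̄ ∥₂< 1ℝ ⇔
       (¬ (∃ λ y → IsEigenvector (B *ᵐ D̄ *ᵐ B) y × Fixes D̄ y × Fixes B y)))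
mainTheorem5 R N U (UᴴU≈I , _) S F =
  mk⇔ (¬localized⇒norm<1 ∘ recoverable⇒¬localized) (¬localized⇒recoverable ∘ norm<1⇒¬localized) ,
  mk⇔ (λ norm<1 (y , eigen) → norm<1⇒¬localized norm<1 (y , eigenvector⇒localized eigen))
      (λ ¬eigen → ¬localized⇒norm<1 λ (y , loc) → ¬eigen (y , localized⇒eigenvector loc))
  where
  open ComplexMatrices R
  open Projections R
  open Sampling {D = 𝐃 S} {B = 𝐁 U F} (indicator-isProjection S)
                (conjugate-isProjection {U = U} UᴴU≈I (indicator-isProjection F))
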